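{- For every $c>0$ and $\varepsilon>0$ there is $n_0$ such that for all $n>n_0$ the following holds. Let $\ell_1,\ell_2$ be lines in $\mathbb{R}^2$, let $P_1$ be a set of $n$ points on $\ell_1$ and $P_2$ a set of $n^{1/2+\varepsilon}$ points on $\ell_2$. If $|D(P_1,P_2)|<cn$, then $\ell_1$ and $\ell_2$ are parallel or orthogonal.
   Context: For point sets $P,Q\subset\mathbb{R}^2$, $D(P,Q)=\{d(p,q): p\in P,\ q\in Q\}$ denotes the set of Euclidean distances between a point of $P$ and a point of $Q$. -}

module Defs where

open import Level using (Level; suc)
open import Algebra.Bundles using (CommutativeRing)
import Algebra.Properties.CommutativeSemiring.Exp
import Algebra.Properties.Ring
import Algebra.Properties.Semiring.Mult
import Algebra.Solver.Ring.NaturalCoefficients.Default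
open import Data.Fin.Base using (Fin)
open import Data.Nat.Base as ℕ using (ℕ; zero; NonZero)
import Data.Nat.Properties as ℕ
open import Data.Product.Base using (∃; ∃₂; _×_; _,_; proj₁; proj₂)
open import Data.Product.Relation.Binary.Pointwise.NonDependent using (×-setoid)
open import Data.Sum.Base using (_⊎_; inj₁; inj₂)
open import Function.Bundles using (Bijection)
open import Relation.Binary.Bundles using (Setoid; StrictTotalOrder)
import Relation.Binary.Construct.On as On
import Relation.Binary.Construct.StrictToNonStrict as StrictToNonStrict
open import Relation.Binary.Core using (Rel)
open import Relation.Binary.Definitions using (tri<; tri≈; tri>)
open import Relation.Binary.PropositionalEquality.Core as ≡ using (_≡_)
import Relation.Binary.PropositionalEquality.Properties as ≡ using (setoid)
import Relation.Binary.Reasoning.StrictPartialOrder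
open import Relation.Binary.Structures using (IsStrictTotalOrder)
open import Relation.Nullary.Negation.Core using (¬_; contradiction)
open import Relation.Unary using (Pred; _∈_)

private
  variable
    a ℓ₀ p : Level

-- The real numbers, described up to isomorphism.  The order is decidable, as
-- it is classically; `archimedean` follows classically from `supremum`, but
-- extracting the natural number constructively requires it as a field.
record CompleteOrderedField (ℓ : Level) : Set (suc ℓ) where
  infix 4 _<_
  field
    commutativeRing : CommutativeRing ℓ ℓ

  open CommutativeRing commutativeRing public hiding (_≉_)
  open Algebra.Properties.Semiring.Mult semiring public
    using () renaming (_×_ to _·_)

  field
    _<_                : Rel Carrier ℓ
    isStrictTotalOrder : IsStrictTotalOrder _≈_ _<_
    0<1                : 0# < 1#
    +-monoˡ-<          : ∀ z {x y} → x < y → x + z < y + z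
    *-pos              : ∀ {x y} → 0# < x → 0# < y → 0# < x * y
    inverse            : ∀ x → ¬ (x ≈ 0#) → ∃ λ y → x * y ≈ 1#

  open StrictToNonStrict _≈_ _<_ public using (_≤_)

  UpperBound : Pred Carrier ℓ → Pred Carrier ℓ
  UpperBound S b = ∀ {x} → x ∈ S → x ≤ b

  Supremum : Pred Carrier ℓ → Pred Carrier ℓ
  Supremum S s = UpperBound S s × (∀ {b} → UpperBound S b → s ≤ b)

  field
    supremum    : ∀ S → ∃ S → ∃ (UpperBound S) → ∃ (Supremum S)
    archimedean : ∀ x → ∃ λ n → x < n · 1#

-- A subset P has exactly k elements, counted up to the equality of S.
HasSize : (S : Setoid a ℓ₀) → Pred (Setoid.Carrier S) p → ℕ → Set _
HasSize S P k = Bijection (≡.setoid (Fin k)) (On.setoid S (proj₁ {B = P}))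

module RealPlane {ℓ : Level} (R : CompleteOrderedField ℓ) where

  open CompleteOrderedField R public
    renaming (Carrier to ℝ; setoid to ℝ-setoid)
  open Algebra.Properties.CommutativeSemiring.Exp commutativeSemiring public

  fromℕ : ℕ → ℝ
  fromℕ n = n · 1#

  private
    module STO = IsStrictTotalOrder isStrictTotalOrder
    module RP = Algebra.Properties.Ring ring
    module MP = Algebra.Properties.Semiring.Mult semiring

    strictTotalOrder : StrictTotalOrder ℓ ℓ ℓ
    strictTotalOrder = record { isStrictTotalOrder = isStrictTotalOrder }

    open Relation.Binary.Reasoning.StrictPartialOrder
      (StrictTotalOrder.strictPartialOrder strictTotalOrder)

    open Algebra.Solver.Ring.NaturalCoefficients.Default commutativeSemiring
      using (solve; _:+_; _:*_; _:=_)

  ≤⇒≯ : ∀ {x y} → x ≤ y → ¬ (y < x)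
  ≤⇒≯ (inj₁ x<y) y<x = STO.asym x<y y<x
  ≤⇒≯ (inj₂ x≈y) y<x = STO.irrefl (sym x≈y) y<x

  ≮⇒≥ : ∀ {x y} → ¬ (x < y) → y ≤ x
  ≮⇒≥ {x} {y} x≮y with STO.compare x y
  ... | tri< x<y _ _ = contradiction x<y x≮y
  ... | tri≈ _ x≈y _ = inj₂ (sym x≈y)
  ... | tri> _ _ y<x = inj₁ y<x

  ≤-trans : ∀ {x y z} → x ≤ y → y ≤ z → x ≤ z
  ≤-trans {x} {y} {z} x≤y y≤z = begin x ≤⟨ x≤y ⟩ y ≤⟨ y≤z ⟩ z ∎

  +-monoʳ-< : ∀ z {x y} → x < y → z + x < z + y
  +-monoʳ-< z {x} {y} x<y = begin-strict
    z + x ≈⟨ +-comm z x ⟩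
    x + z <⟨ +-monoˡ-< z x<y ⟩
    y + z ≈⟨ +-comm y z ⟩
    z + y ∎

  +-monoˡ-≤ : ∀ z {x y} → x ≤ y → x + z ≤ y + z
  +-monoˡ-≤ z (inj₁ x<y) = inj₁ (+-monoˡ-< z x<y)
  +-monoˡ-≤ z (inj₂ x≈y) = inj₂ (+-congʳ x≈y)

  +-monoʳ-≤ : ∀ z {x y} → x ≤ y → z + x ≤ z + y
  +-monoʳ-≤ z (inj₁ x<y) = inj₁ (+-monoʳ-< z x<y)
  +-monoʳ-≤ z (inj₂ x≈y) = inj₂ (+-congˡ x≈y)

  x<x+y : ∀ x {y} → 0# < y → x < x + y
  x<x+y x {y} 0<y = begin-strict
    x      ≈⟨ +-identityʳ x ⟨
    x + 0# <⟨ +-monoʳ-< x 0<y ⟩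
    x + y  ∎

  x≤x+y : ∀ x {y} → 0# ≤ y → x ≤ x + y
  x≤x+y x {y} 0≤y = begin
    x      ≈⟨ +-identityʳ x ⟨
    x + 0# ≤⟨ +-monoʳ-≤ x 0≤y ⟩
    x + y  ∎

  +-nonneg : ∀ {x y} → 0# ≤ x → 0# ≤ y → 0# ≤ x + y
  +-nonneg {x} {y} 0≤x 0≤y = ≤-trans 0≤x (x≤x+y x 0≤y)

  +-nonneg-pos : ∀ {x y} → 0# ≤ x → 0# < y → 0# < x + y
  +-nonneg-pos {x} {y} 0≤x 0<y = begin-strict
    0#     ≤⟨ 0≤x ⟩
    x      <⟨ x<x+y x 0<y ⟩
    x + y  ∎

  difference : ∀ {x y} → x < y → ∃ λ d → 0# < d × y ≈ x + d
  difference {x} {y} x<y = y - x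
    , (begin-strict
        0#     ≈⟨ -‿inverseʳ x ⟨
        x - x  <⟨ +-monoˡ-< (- x) x<y ⟩
        y - x  ∎)
    , (begin-equality
        y            ≈⟨ RP.//-rightDividesˡ x y ⟨
        (y - x) + x  ≈⟨ +-comm _ x ⟩
        x + (y - x)  ∎)

  *-monoˡ-< : ∀ {z x y} → 0# < z → x < y → z * x < z * y
  *-monoˡ-< {z} {x} {y} 0<z x<y with difference x<y
  ... | d , 0<d , y≈x+d = begin-strict
    z * x          <⟨ x<x+y _ (*-pos 0<z 0<d) ⟩
    z * x + z * d  ≈⟨ distribˡ z x d ⟨
    z * (x + d)    ≈⟨ *-congˡ y≈x+d ⟨
    z * y          ∎

  *-monoˡ-≤ : ∀ {z x y} → 0# ≤ z → x ≤ y → z * x ≤ z * y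
  *-monoˡ-≤ (inj₁ 0<z) (inj₁ x<y) = inj₁ (*-monoˡ-< 0<z x<y)
  *-monoˡ-≤ {z} {x} {y} (inj₂ 0≈z) (inj₁ _) = inj₂ (begin-equality
    z * x   ≈⟨ *-congʳ 0≈z ⟨
    0# * x  ≈⟨ zeroˡ x ⟩
    0#      ≈⟨ zeroˡ y ⟨
    0# * y  ≈⟨ *-congʳ 0≈z ⟩
    z * y   ∎)
  *-monoˡ-≤ _ (inj₂ x≈y) = inj₂ (*-congˡ x≈y)

  *-monoʳ-≤ : ∀ {z x y} → 0# ≤ z → x ≤ y → x * z ≤ y * z
  *-monoʳ-≤ {z} {x} {y} 0≤z x≤y = begin
    x * z  ≈⟨ *-comm x z ⟩
    z * x  ≤⟨ *-monoˡ-≤ 0≤z x≤y ⟩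
    z * y  ≈⟨ *-comm z y ⟩
    y * z  ∎

  *-cancelʳ-≤ : ∀ {z x y} → 0# < z → x * z ≤ y * z → x ≤ y
  *-cancelʳ-≤ {z} {x} {y} 0<z xz≤yz = ≮⇒≥ λ y<x → ≤⇒≯ xz≤yz (begin-strict
    y * z  ≈⟨ *-comm y z ⟩
    z * y  <⟨ *-monoˡ-< 0<z y<x ⟩
    z * x  ≈⟨ *-comm z x ⟩
    x * z  ∎)

  *-nonneg : ∀ {x y} → 0# ≤ x → 0# ≤ y → 0# ≤ x * y
  *-nonneg {x} {y} 0≤x 0≤y = begin
    0#      ≈⟨ zeroʳ x ⟨
    x * 0#  ≤⟨ *-monoˡ-≤ 0≤x 0≤y ⟩
    x * y   ∎

  square-nonneg : ∀ x → 0# ≤ x * x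
  square-nonneg x with STO.compare 0# x
  ... | tri< 0<x _ _ = inj₁ (*-pos 0<x 0<x)
  ... | tri≈ _ 0≈x _ = inj₂ (begin-equality
    0#      ≈⟨ zeroˡ x ⟨
    0# * x  ≈⟨ *-congʳ 0≈x ⟩
    x * x   ∎)
  ... | tri> _ _ x<0 = inj₁ (begin-strict
    0#           <⟨ *-pos 0<-x 0<-x ⟩
    - x * - x    ≈⟨ RP.-‿distribˡ-* x (- x) ⟨
    - (x * - x)  ≈⟨ -‿cong (RP.-‿distribʳ-* x x) ⟨
    - - (x * x)  ≈⟨ RP.-‿involutive (x * x) ⟩
    x * x        ∎)
    where
    0<-x : 0# < - x
    0<-x = begin-strict
      0#      ≈⟨ -‿inverseʳ x ⟨
      x - x   <⟨ +-monoˡ-< (- x) x<0 ⟩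
      0# - x  ≈⟨ +-identityˡ _ ⟩
      - x     ∎

  square-mono-< : ∀ {x y} → 0# ≤ x → x < y → x * x < y * y
  square-mono-< {x} {y} 0≤x x<y = begin-strict
    x * x  ≤⟨ *-monoˡ-≤ 0≤x (inj₁ x<y) ⟩
    x * y  ≈⟨ *-comm x y ⟩
    y * x  <⟨ *-monoˡ-< (begin-strict 0# ≤⟨ 0≤x ⟩ x <⟨ x<y ⟩ y ∎) x<y ⟩
    y * y  ∎

  pos⇒≉0 : ∀ {x} → 0# < x → ¬ (x ≈ 0#)
  pos⇒≉0 0<x x≈0 = STO.irrefl (sym x≈0) 0<x

  inverse-pos : ∀ {x y} → 0# < x → x * y ≈ 1# → 0# < y
  inverse-pos {x} {y} 0<x xy≈1 with STO.compare 0# y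
  ... | tri< 0<y _ _ = 0<y
  ... | tri≈ _ 0≈y _ = contradiction
    (begin-equality 1# ≈⟨ xy≈1 ⟨ x * y ≈⟨ *-congˡ 0≈y ⟨ x * 0# ≈⟨ zeroʳ x ⟩ 0# ∎)
    (pos⇒≉0 0<1)
  ... | tri> _ _ y<0 = contradiction
    (begin-strict 1# ≈⟨ xy≈1 ⟨ x * y <⟨ *-monoˡ-< 0<x y<0 ⟩ x * 0# ≈⟨ zeroʳ x ⟩ 0# ∎)
    (STO.asym 0<1)

  0≤1 : 0# ≤ 1#
  0≤1 = inj₁ 0<1

  2# : ℝ
  2# = 1# + 1#

  0<2 : 0# < 2#
  0<2 = +-nonneg-pos 0≤1 0<1

  half : ∃ λ h → 2# * h ≈ 1#
  half = inverse 2# (pos⇒≉0 0<2)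

  ½ : ℝ
  ½ = proj₁ half

  private module SquareRoot (s : ℝ) (0≤s : 0# ≤ s) where

    Below : Pred ℝ ℓ
    Below z = z * z ≤ s

    sup : ∃ (Supremum Below)
    sup = supremum Below
      (0# , (begin 0# * 0# ≈⟨ zeroˡ 0# ⟩ 0# ≤⟨ 0≤s ⟩ s ∎))
      (s + 1# , λ {z} zz≤s → ≮⇒≥ λ s+1<z → ≤⇒≯ zz≤s (begin-strict
        s                          ≈⟨ *-identityʳ s ⟨
        s * 1#                     ≤⟨ *-monoˡ-≤ 0≤s 1≤s+1 ⟩
        s * (s + 1#)               <⟨ x<x+y _ 0<s+1 ⟩
        s * (s + 1#) + (s + 1#)    ≈⟨ +-congˡ (*-identityˡ _) ⟨
        s * (s + 1#) + 1# * (s + 1#) ≈⟨ distribʳ (s + 1#) s 1# ⟨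
        (s + 1#) * (s + 1#)        <⟨ square-mono-< (inj₁ 0<s+1) s+1<z ⟩
        z * z                      ∎))
      where
      0<s+1 : 0# < s + 1#
      0<s+1 = +-nonneg-pos 0≤s 0<1
      1≤s+1 : 1# ≤ s + 1#
      1≤s+1 = begin 1# ≤⟨ x≤x+y 1# 0≤s ⟩ 1# + s ≈⟨ +-comm 1# s ⟩ s + 1# ∎

    u : ℝ
    u = proj₁ sup

    0≤u : 0# ≤ u
    0≤u = proj₁ (proj₂ sup) (begin 0# * 0# ≈⟨ zeroˡ 0# ⟩ 0# ≤⟨ 0≤s ⟩ s ∎)

    ≮s : ¬ (u * u < s)
    ≮s uu<s with difference uu<s
    ... | e , 0<e , s≈uu+e
      with 0<w ← +-nonneg-pos (+-nonneg (+-nonneg 0≤u 0≤u) 0≤1) 0<e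
      with inverse ((u + u + 1#) + e) (pos⇒≉0 0<w)
    ... | i , wi≈1 = ≤⇒≯ (proj₁ (proj₂ sup) u+δ∈) (x<x+y u 0<δ)
      where
      w δ : ℝ
      w = (u + u + 1#) + e
      δ = e * i

      0<i : 0# < i
      0<i = inverse-pos 0<w wi≈1

      0<δ : 0# < δ
      0<δ = *-pos 0<e 0<i

      δ≤1 : δ ≤ 1#
      δ≤1 = begin
        e * i                      ≤⟨ *-monoʳ-≤ (inj₁ 0<i) (begin
          e                 ≤⟨ x≤x+y e (+-nonneg (+-nonneg 0≤u 0≤u) 0≤1) ⟩
          e + (u + u + 1#)  ≈⟨ +-comm e _ ⟩
          w                 ∎) ⟩
        w * i                      ≈⟨ wi≈1 ⟩
        1#                         ∎

      u+δ∈ : (u + δ) * (u + δ) ≤ s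
      u+δ∈ = begin
        (u + δ) * (u + δ)          ≈⟨ solve 2 (λ u δ → (u :+ δ) :* (u :+ δ)
                                        := u :* u :+ δ :* (u :+ u :+ δ)) refl u δ ⟩
        u * u + δ * (u + u + δ)    ≤⟨ +-monoʳ-≤ _ (*-monoˡ-≤ (inj₁ 0<δ)
                                        (≤-trans (+-monoʳ-≤ _ δ≤1) (x≤x+y _ (inj₁ 0<e)))) ⟩
        u * u + δ * w              ≈⟨ solve 4 (λ u e i w → u :* u :+ (e :* i) :* w
                                        := u :* u :+ e :* (w :* i)) refl u e i w ⟩
        u * u + e * (w * i)        ≈⟨ +-congˡ (*-congˡ wi≈1) ⟩
        u * u + e * 1#             ≈⟨ +-congˡ (*-identityʳ e) ⟩
        u * u + e                  ≈⟨ s≈uu+e ⟨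
        s                          ∎

    ≯s : ¬ (s < u * u)
    ≯s s<uu with difference s<uu | 0≤u
    ... | e , 0<e , uu≈s+e | inj₂ 0≈u = ≤⇒≯ 0≤s (begin-strict
      s       <⟨ s<uu ⟩
      u * u   ≈⟨ *-congʳ 0≈u ⟨
      0# * u  ≈⟨ zeroˡ u ⟩
      0#      ∎)
    ... | e , 0<e , uu≈s+e | inj₁ 0<u
      with 0<2u ← +-nonneg-pos 0≤u 0<u
      with inverse (u + u) (pos⇒≉0 0<2u)
    ... | i , 2ui≈1 = ≤⇒≯ (proj₂ (proj₂ sup) v-bound) v<u
      where
      v : ℝ
      v = (u * u + s) * i

      0<i : 0# < i
      0<i = inverse-pos 0<2u 2ui≈1

      0≤v : 0# ≤ v
      0≤v = *-nonneg (+-nonneg (square-nonneg u) 0≤s) (inj₁ 0<i)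

      2uv : (u + u) * v ≈ u * u + s
      2uv = begin-equality
        (u + u) * ((u * u + s) * i)    ≈⟨ solve 3 (λ w t i → w :* (t :* i) := t :* (w :* i))
                                            refl (u + u) (u * u + s) i ⟩
        (u * u + s) * ((u + u) * i)    ≈⟨ *-congˡ 2ui≈1 ⟩
        (u * u + s) * 1#               ≈⟨ *-identityʳ _ ⟩
        u * u + s                      ∎

      v<u : v < u
      v<u = begin-strict
        (u * u + s) * i      ≈⟨ *-comm _ i ⟩
        i * (u * u + s)      <⟨ *-monoˡ-< 0<i (+-monoʳ-< (u * u) s<uu) ⟩
        i * (u * u + u * u)  ≈⟨ solve 2 (λ u i → i :* (u :* u :+ u :* u)
                                  := u :* ((u :+ u) :* i)) refl u i ⟩
        u * ((u + u) * i)    ≈⟨ *-congˡ 2ui≈1 ⟩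
        u * 1#               ≈⟨ *-identityʳ u ⟩
        u                    ∎

      s≤vv : s ≤ v * v
      s≤vv = *-cancelʳ-≤ (*-pos 0<2u 0<2u) (begin
        s * ((u + u) * (u + u))
          ≈⟨ solve 2 (λ u s → s :* ((u :+ u) :* (u :+ u))
               := (s :+ s :+ s :+ s) :* (u :* u)) refl u s ⟩
        (s + s + s + s) * (u * u)
          ≈⟨ *-congˡ uu≈s+e ⟩
        (s + s + s + s) * (s + e)
          ≤⟨ x≤x+y _ (square-nonneg e) ⟩
        (s + s + s + s) * (s + e) + e * e
          ≈⟨ solve 2 (λ s e → (s :+ s :+ s :+ s) :* (s :+ e) :+ e :* e
               := ((s :+ e) :+ s) :* ((s :+ e) :+ s)) refl s e ⟩
        ((s + e) + s) * ((s + e) + s)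
          ≈⟨ *-cong (+-congʳ uu≈s+e) (+-congʳ uu≈s+e) ⟨
        (u * u + s) * (u * u + s)
          ≈⟨ *-cong 2uv 2uv ⟨
        ((u + u) * v) * ((u + u) * v)
          ≈⟨ solve 2 (λ w v → (w :* v) :* (w :* v) := (v :* v) :* (w :* w)) refl (u + u) v ⟩
        (v * v) * ((u + u) * (u + u)) ∎)

      v-bound : UpperBound Below v
      v-bound {z} zz≤s = ≮⇒≥ λ v<z → ≤⇒≯ zz≤s (begin-strict
        s      ≤⟨ s≤vv ⟩
        v * v  <⟨ square-mono-< 0≤v v<z ⟩
        z * z  ∎)

    uu≈s : u * u ≈ s
    uu≈s with STO.compare (u * u) s
    ... | tri< uu<s _ _ = contradiction uu<s ≮s
    ... | tri≈ _ uu≈s _ = uu≈s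
    ... | tri> _ _ s<uu = contradiction s<uu ≯s

  abstract
    squareRoot : ∀ s → 0# ≤ s → ∃ λ r → 0# ≤ r × r * r ≈ s
    squareRoot s 0≤s = u , 0≤u , uu≈s
      where open SquareRoot s 0≤s

  √ : ∀ s → 0# ≤ s → ℝ
  √ s 0≤s = proj₁ (squareRoot s 0≤s)

  -- The powers bʳ with r = (i − j) / (q + 1) a rational number such that r ≤ x.
  RationalPowers : ℝ → ℝ → Pred ℝ ℓ
  RationalPowers b x z = 0# ≤ z × ∃ λ i → ∃₂ λ j q →
    fromℕ i ≤ fromℕ (ℕ.suc q) * x + fromℕ j × z ^ ℕ.suc q * b ^ j ≈ b ^ i

  pow-nonneg : ∀ {x} n → 0# ≤ x → 0# ≤ x ^ n
  pow-nonneg zero      0≤x = 0≤1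
  pow-nonneg (ℕ.suc n) 0≤x = *-nonneg 0≤x (pow-nonneg n 0≤x)

  pow-mono-≤ : ∀ {x y} n → 0# ≤ x → x ≤ y → x ^ n ≤ y ^ n
  pow-mono-≤ zero      0≤x x≤y = inj₂ refl
  pow-mono-≤ {x} {y} (ℕ.suc n) 0≤x x≤y = begin
    x * x ^ n  ≤⟨ *-monoˡ-≤ 0≤x (pow-mono-≤ n 0≤x x≤y) ⟩
    x * y ^ n  ≤⟨ *-monoʳ-≤ (pow-nonneg n (≤-trans 0≤x x≤y)) x≤y ⟩
    y * y ^ n  ∎

  pow-pos : ∀ {x} n → 0# < x → 0# < x ^ n
  pow-pos zero      0<x = 0<1
  pow-pos (ℕ.suc n) 0<x = *-pos 0<x (pow-pos n 0<x)

  pow-mono-< : ∀ {x y} n → 0# ≤ x → x < y → x ^ ℕ.suc n < y ^ ℕ.suc n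
  pow-mono-< {x} {y} n 0≤x x<y = begin-strict
    x * x ^ n  ≤⟨ *-monoˡ-≤ 0≤x (pow-mono-≤ n 0≤x (inj₁ x<y)) ⟩
    x * y ^ n  ≈⟨ *-comm x _ ⟩
    y ^ n * x  <⟨ *-monoˡ-< (pow-pos n 0<y) x<y ⟩
    y ^ n * y  ≈⟨ *-comm _ y ⟩
    y * y ^ n  ∎
    where
    0<y : 0# < y
    0<y = begin-strict 0# ≤⟨ 0≤x ⟩ x <⟨ x<y ⟩ y ∎

  1≤pow : ∀ {b} n → 1# ≤ b → 1# ≤ b ^ n
  1≤pow zero      1≤b = inj₂ refl
  1≤pow {b} (ℕ.suc n) 1≤b = begin
    1#         ≤⟨ 1≤b ⟩
    b          ≈⟨ *-identityʳ b ⟨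
    b * 1#     ≤⟨ *-monoˡ-≤ (≤-trans 0≤1 1≤b) (1≤pow n 1≤b) ⟩
    b * b ^ n  ∎

  pow-monoʳ-≤ : ∀ {b m n} → 1# ≤ b → m ℕ.≤ n → b ^ m ≤ b ^ n
  pow-monoʳ-≤ 1≤b (ℕ.z≤n {n}) = 1≤pow n 1≤b
  pow-monoʳ-≤ 1≤b (ℕ.s≤s m≤n) = *-monoˡ-≤ (≤-trans 0≤1 1≤b) (pow-monoʳ-≤ 1≤b m≤n)

  0≤fromℕ : ∀ n → 0# ≤ fromℕ n
  0≤fromℕ zero      = inj₂ refl
  0≤fromℕ (ℕ.suc n) = +-nonneg 0≤1 (0≤fromℕ n)

  1≤fromℕ : ∀ n .{{_ : NonZero n}} → 1# ≤ fromℕ n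
  1≤fromℕ (ℕ.suc n) = x≤x+y 1# (0≤fromℕ n)

  fromℕ-mono-< : ∀ {m n} → m ℕ.< n → fromℕ m < fromℕ n
  fromℕ-mono-< {n = ℕ.suc n} (ℕ.s≤s ℕ.z≤n) = begin-strict
    0#            <⟨ 0<1 ⟩
    1#            ≤⟨ 1≤fromℕ (ℕ.suc n) ⟩
    1# + fromℕ n  ∎
  fromℕ-mono-< (ℕ.s≤s m<n@(ℕ.s≤s _)) = +-monoʳ-< 1# (fromℕ-mono-< m<n)

  fromℕ-reflects-≤ : ∀ {m n} → fromℕ m ≤ fromℕ n → m ℕ.≤ n
  fromℕ-reflects-≤ m≤n = ℕ.≮⇒≥ λ n<m → ≤⇒≯ m≤n (fromℕ-mono-< n<m)

  RationalPowers-inhabited : ∀ b x → 1# ≤ b → ∃ (RationalPowers b x)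
  RationalPowers-inhabited b x 1≤b
    with archimedean (- x)
  ... | j , -x<j
    with 0<bʲ ← pow-pos j (begin-strict 0# <⟨ 0<1 ⟩ 1# ≤⟨ 1≤b ⟩ b ∎)
    with inverse (b ^ j) (pos⇒≉0 0<bʲ)
  ... | z , bʲz≈1 = z , inj₁ (inverse-pos 0<bʲ bʲz≈1) , 0 , j , 0 ,
    (begin
      0#                  ≈⟨ -‿inverseʳ x ⟨
      x - x               ≤⟨ +-monoʳ-≤ x (inj₁ -x<j) ⟩
      x + fromℕ j         ≈⟨ +-congʳ (trans (*-congʳ (+-identityʳ 1#)) (*-identityˡ x)) ⟨
      (1# + 0#) * x + fromℕ j ∎) ,
    (begin-equality
      z * 1# * b ^ j      ≈⟨ *-congʳ (*-identityʳ z) ⟩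
      z * b ^ j           ≈⟨ *-comm z _ ⟩
      b ^ j * z           ≈⟨ bʲz≈1 ⟩
      1#                  ∎)

  RationalPowers-bounded : ∀ b x → 1# ≤ b → ∃ (UpperBound (RationalPowers b x))
  RationalPowers-bounded b x 1≤b with archimedean x
  ... | N , x<N = b ^ N , λ {z} → bound {z}
    where
    0<b : 0# < b
    0<b = begin-strict 0# <⟨ 0<1 ⟩ 1# ≤⟨ 1≤b ⟩ b ∎

    bound : UpperBound (RationalPowers b x) (b ^ N)
    bound {z} (0≤z , i , j , q , i≤ , eq) = ≮⇒≥ λ bᴺ<z →
      ≤⇒≯ zᑫ≤ (pow-mono-< q (pow-nonneg N (inj₁ 0<b)) bᴺ<z)
      where
      Q : ℕ
      Q = ℕ.suc q

      i≤ℕ : i ℕ.≤ N ℕ.* Q ℕ.+ j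
      i≤ℕ = fromℕ-reflects-≤ (begin
        fromℕ i                      ≤⟨ i≤ ⟩
        fromℕ Q * x + fromℕ j        ≤⟨ +-monoˡ-≤ _ (*-monoˡ-≤ (0≤fromℕ Q) (inj₁ x<N)) ⟩
        fromℕ Q * fromℕ N + fromℕ j  ≈⟨ +-congʳ (*-comm _ _) ⟩
        fromℕ N * fromℕ Q + fromℕ j  ≈⟨ +-congʳ (MP.×1-homo-* N Q) ⟨
        fromℕ (N ℕ.* Q) + fromℕ j    ≈⟨ MP.×-homo-+ 1# (N ℕ.* Q) j ⟨
        fromℕ (N ℕ.* Q ℕ.+ j)        ∎)

      zᑫ≤ : z ^ Q ≤ (b ^ N) ^ Q
      zᑫ≤ = *-cancelʳ-≤ (pow-pos j 0<b) (begin
        z ^ Q * b ^ j           ≈⟨ eq ⟩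
        b ^ i                   ≤⟨ pow-monoʳ-≤ 1≤b i≤ℕ ⟩
        b ^ (N ℕ.* Q ℕ.+ j)     ≈⟨ ^-homo-* b (N ℕ.* Q) j ⟩
        b ^ (N ℕ.* Q) * b ^ j   ≈⟨ *-congʳ (^-assocʳ b N Q) ⟨
        (b ^ N) ^ Q * b ^ j     ∎)

  realPower : ∀ b x → 1# ≤ b → ∃ (Supremum (RationalPowers b x))
  realPower b x 1≤b = supremum (RationalPowers b x)
    (RationalPowers-inhabited b x 1≤b) (RationalPowers-bounded b x 1≤b)

  -- For b ≥ 1, bˣ is the supremum of the bʳ over all rational r ≤ x.
  infixr 8 _^ʳ_
  _^ʳ_ : (n : ℕ) .{{_ : NonZero n}} → ℝ → ℝ
  n ^ʳ x = proj₁ (realPower (fromℕ n) x (1≤fromℕ n))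

  -- m is x rounded up or down to an integer: |m − x| < 1.
  _isRoundingOf_ : ℕ → ℝ → Set ℓ
  m isRoundingOf x = fromℕ m < x + 1# × x < fromℕ m + 1#

  ℝ²-setoid : Setoid ℓ ℓ
  ℝ²-setoid = ×-setoid ℝ-setoid ℝ-setoid

  open Setoid ℝ²-setoid public using () renaming (Carrier to ℝ²; _≈_ to _≈²_)

  d : ℝ² → ℝ² → ℝ
  d (x₁ , y₁) (x₂ , y₂) = √ ((x₁ - x₂) * (x₁ - x₂) + (y₁ - y₂) * (y₁ - y₂))
    (+-nonneg (square-nonneg _) (square-nonneg _))

  D : Pred ℝ² ℓ → Pred ℝ² ℓ → Pred ℝ ℓ
  D P Q x = ∃₂ λ p q → p ∈ P × q ∈ Q × x ≈ d p q

  infixl 6 _+²_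
  _+²_ : ℝ² → ℝ² → ℝ²
  (x₁ , y₁) +² (x₂ , y₂) = x₁ + x₂ , y₁ + y₂

  infixr 7 _*²_
  _*²_ : ℝ → ℝ² → ℝ²
  t *² (x , y) = t * x , t * y

  _∙_ : ℝ² → ℝ² → ℝ
  (x₁ , y₁) ∙ (x₂ , y₂) = x₁ * x₂ + y₁ * y₂

  record Line : Set ℓ where
    field
      base        : ℝ²
      direction   : ℝ²
      direction≉0 : ¬ (direction ≈² (0# , 0#))

  open Line public

  ⟦_⟧ : Line → Pred ℝ² ℓ
  ⟦ l ⟧ p = ∃ λ t → p ≈² base l +² t *² direction l

  -- Coinciding lines count as parallel.
  Parallel : Line → Line → Set ℓ
  Parallel l m = ∃ λ t → direction m ≈² t *² direction l

  Orthogonal : Line → Line → Set ℓ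
  Orthogonal l m = direction l ∙ direction m ≈ 0#

{-# OPTIONS --safe #-}

-- If the lines are neither parallel nor orthogonal, the squared distance of the
-- points with parameters s and t is f(s, t) = As² + 2Bst + Ct² + 2Ds + 2Et + F
-- with A > 0, B ≠ 0 and AC ≠ B².  By Cauchy-Schwarz, many pairs of points
-- (s, t), (s′, t′) have f(s, t) = f(s′, t′), with s and s′ on the same side of the
-- vertices of f(·, t) and f(·, t′).  For fixed t, t′ the points (s, s′) of this
-- kind form an increasing chain.  Cut the n parameters into blocks of a large constant
-- length L: a chain meets O(n/L) cells of the resulting grid, so most of its
-- points have a predecessor on the chain in the same cell.  For t ≠ t′, two points
-- of the grid lie on at most two of the curves, hence there are O(n²L²) such neighbours
-- in total.  Altogether m²n²/k = O(mn + m²n/L + n²L²), which is impossible when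
-- k = O(n) and m²/n is large.
module Submission where

open import Defs
open import Algebra.Bundles using (CommutativeRing)
import Algebra.Properties.AbelianGroup
import Algebra.Properties.Ring
import Algebra.Properties.Semiring.Mult
import Algebra.Properties.Semiring.Sum
import Algebra.Solver.Ring
open import Algebra.Solver.Ring.AlmostCommutativeRing
  using (_-Raw-AlmostCommutative⟶_; fromCommutativeRing)
open import Data.Bool.Base using (Bool; true; false)
import Data.Empty.Polymorphic as Poly
open import Data.Fin.Base using (Fin; zero; suc; fromℕ<; combine)
import Data.Fin.Properties as Fin
open import Data.Integer.Base as ℤ using (ℤ)
import Data.Integer.Properties as ℤ
import Data.Maybe.Base as Maybe
open import Data.Nat.Base as ℕ using (ℕ; zero; suc; NonZero)
open import Data.Nat.DivMod using (_/_; _%_; m%n<n; m≡m%n+[m/n]*n; m/n*n≤m; /-monoˡ-≤)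
import Data.Nat.Properties as ℕ
open import Data.Nat.Tactic.RingSolver using (solve-∀)
open import Data.Product.Base using (∃; ∃₂; _×_; _,_; proj₁; proj₂)
open import Data.Product.Function.NonDependent.Propositional using (_×-↔_)
open import Data.Sum.Base using (_⊎_; inj₁; inj₂)
open import Data.Sum.Function.Propositional using (_⊎-↔_)
import Data.Unit.Polymorphic.Base as Poly
open import Data.Vec.Functional using (Vector)
open import Function.Base using (_∘_)
open import Function.Bundles using (_↔_; Bijection; Injection; Inverse)
open import Function.Properties.Inverse using (↔-refl; ↔-sym; ↔-trans; ↔⇒↣)
open import Relation.Binary.Bundles using (StrictTotalOrder)
open import Relation.Binary.Definitions using (tri<; tri≈; tri>)
open import Relation.Binary.PropositionalEquality as ≡ using (_≡_; _≢_; cong; cong₂)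
import Relation.Binary.Reasoning.Setoid
import Relation.Binary.Reasoning.StrictPartialOrder
open import Relation.Binary.Structures using (IsStrictTotalOrder)
open import Relation.Nullary using (¬_; Dec; yes; no; does; contradiction; _×-dec_)
open import Relation.Nullary.Decidable using (dec⇒maybe)
open import Relation.Unary using (Pred; _⊆_)

open Algebra.Properties.Semiring.Sum ℕ.+-*-semiring
  using (sum; ∑-comm; sum-cong-≗; *-distribˡ-sum; *-distribʳ-sum)

-- Counting in finite types

module _ where
  open import Data.Nat.Base using (_+_; _*_; _≤_; _<_)
  open ℕ.≤-Reasoning

  indicator : ∀ {a} {A : Set a} → Dec A → ℕ
  indicator (yes _) = 1
  indicator (no  _) = 0

  indicator≤1 : ∀ {a} {A : Set a} (A? : Dec A) → indicator A? ≤ 1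
  indicator≤1 (yes _) = ℕ.≤-refl
  indicator≤1 (no  _) = ℕ.z≤n

  indicator≢0⇒ : ∀ {a} {A : Set a} (A? : Dec A) → indicator A? ≢ 0 → A
  indicator≢0⇒ (yes x) _   = x
  indicator≢0⇒ (no  _) 0≢0 = contradiction ≡.refl 0≢0

  indicator-yes : ∀ {a} {A : Set a} (A? : Dec A) → A → indicator A? ≡ 1
  indicator-yes (yes _) _ = ≡.refl
  indicator-yes (no ¬x) x = contradiction x ¬x

  indicator-no : ∀ {a} {A : Set a} (A? : Dec A) → ¬ A → indicator A? ≡ 0
  indicator-no (yes x) ¬x = contradiction x ¬x
  indicator-no (no _)  _  = ≡.refl

  indicator-mono : ∀ {a b} {A : Set a} {B : Set b} (A? : Dec A) (B? : Dec B) →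
    (A → B) → indicator A? ≤ indicator B?
  indicator-mono (no _)  _  _ = ℕ.z≤n
  indicator-mono (yes x) B? f = ℕ.≤-reflexive (≡.sym (indicator-yes B? (f x)))

  sum-mono-≤ : ∀ {n} {f g : Vector ℕ n} → (∀ i → f i ≤ g i) → sum f ≤ sum g
  sum-mono-≤ {zero}  f≤g = ℕ.z≤n
  sum-mono-≤ {suc n} f≤g = ℕ.+-mono-≤ (f≤g zero) (sum-mono-≤ (f≤g ∘ suc))

  sum-mono-< : ∀ {n} {f g : Vector ℕ n} → (∀ i → f i ≤ g i) →
    ∀ i → f i < g i → sum f < sum g
  sum-mono-< f≤g zero    f<g = ℕ.+-mono-<-≤ f<g (sum-mono-≤ (f≤g ∘ suc))
  sum-mono-< f≤g (suc i) f<g = ℕ.+-mono-≤-< (f≤g zero) (sum-mono-< (f≤g ∘ suc) i f<g)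

  sum-const : ∀ n c → sum {n} (λ _ → c) ≡ n * c
  sum-const zero    c = ≡.refl
  sum-const (suc n) c = cong (c +_) (sum-const n c)

  sum-zero : ∀ {n} (f : Vector ℕ n) → (∀ i → f i ≡ 0) → sum f ≡ 0
  sum-zero {n} f f≡0 = ≡.trans (sum-cong-≗ f≡0) (≡.trans (sum-const n 0) (ℕ.*-zeroʳ n))

  sum≢0⇒∃ : ∀ {n} (f : Vector ℕ n) → sum f ≢ 0 → ∃ λ i → f i ≢ 0
  sum≢0⇒∃ {zero}  f 0≢0 = contradiction ≡.refl 0≢0
  sum≢0⇒∃ {suc n} f ≢0 with f zero ℕ.≟ 0
  ... | no f₀≢0 = zero , f₀≢0
  ... | yes f₀≡0 with i , fᵢ≢0 ← sum≢0⇒∃ (f ∘ suc) (≢0 ∘ cong₂ _+_ f₀≡0) = suc i , fᵢ≢0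

  sum≤1 : ∀ {n} {f : Vector ℕ n} → (∀ i → f i ≤ 1) →
    (∀ i j → f i ≢ 0 → f j ≢ 0 → i ≡ j) → sum f ≤ 1
  sum≤1 {zero}      _   _    = ℕ.z≤n
  sum≤1 {suc n} {f} f≤1 uniq with f zero ℕ.≟ 0
  ... | yes f₀≡0 rewrite f₀≡0 =
    sum≤1 (f≤1 ∘ suc) (λ i j i≢0 j≢0 → Fin.suc-injective (uniq _ _ i≢0 j≢0))
  ... | no  f₀≢0 = begin
    f zero + sum (f ∘ suc) ≡⟨ cong (f zero +_) (sum-zero (f ∘ suc) tail≡0) ⟩
    f zero + 0             ≡⟨ ℕ.+-identityʳ _ ⟩
    f zero                 ≤⟨ f≤1 zero ⟩
    1                      ∎
    where
    tail≡0 : ∀ i → f (suc i) ≡ 0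
    tail≡0 i with f (suc i) ℕ.≟ 0
    ... | yes ≡0 = ≡0
    ... | no  ≢0 = contradiction (uniq _ _ f₀≢0 ≢0) λ ()

  sum-indicator : ∀ {n} (y : Fin n) → sum (λ x → indicator (y Fin.≟ x)) ≡ 1
  sum-indicator {suc n} zero    = cong suc (sum-zero {n} (λ _ → 0) λ _ → ≡.refl)
  sum-indicator {suc n} (suc y) = ≡.trans (sum-cong-≗ shift) (sum-indicator y)
    where
    shift : ∀ x → indicator (suc y Fin.≟ suc x) ≡ indicator (y Fin.≟ x)
    shift x = ℕ.≤-antisym
      (indicator-mono (suc y Fin.≟ suc x) (y Fin.≟ x) Fin.suc-injective)
      (indicator-mono (y Fin.≟ x) (suc y Fin.≟ suc x) (cong suc))

  -- Once the larger number is written as the smaller one plus `d`, the two sides differ by `d * d`.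
  -- The case split keeps truncated subtraction out of the identities.
  2ab≤a²+b² : ∀ a b → 2 * (a * b) ≤ a * a + b * b
  2ab≤a²+b² a b with ℕ.≤-total a b
  ... | inj₁ a≤b rewrite ≡.sym (ℕ.m+[n∸m]≡n a≤b) = lemma a (b ℕ.∸ a)
    where
    identity : ∀ a d → a * a + (a + d) * (a + d) ≡ 2 * (a * (a + d)) + d * d
    identity = solve-∀
    lemma : ∀ a d → 2 * (a * (a + d)) ≤ a * a + (a + d) * (a + d)
    lemma a d = ℕ.≤-trans (ℕ.m≤m+n _ (d * d)) (ℕ.≤-reflexive (≡.sym (identity a d)))
  ... | inj₂ b≤a rewrite ≡.sym (ℕ.m+[n∸m]≡n b≤a) = lemma b (a ℕ.∸ b)
    where
    identity : ∀ b d → (b + d) * (b + d) + b * b ≡ 2 * ((b + d) * b) + d * d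
    identity = solve-∀
    lemma : ∀ b d → 2 * ((b + d) * b) ≤ (b + d) * (b + d) + b * b
    lemma b d = ℕ.≤-trans (ℕ.m≤m+n _ (d * d)) (ℕ.≤-reflexive (≡.sym (identity b d)))

  -- Induction on `k`: splitting off the head leaves the cross term `2 * (a * R)`, which `cross`
  -- bounds summand by summand through `2ab≤a²+b²`.
  cauchySchwarz : ∀ {k} (r : Vector ℕ k) → sum r * sum r ≤ k * sum (λ x → r x * r x)
  cauchySchwarz {zero}  r = ℕ.z≤n
  cauchySchwarz {suc k} r = begin
    (a + R) * (a + R)                   ≡⟨ expand a R ⟩
    a * a + 2 * (a * R) + R * R         ≤⟨ ℕ.+-mono-≤ (ℕ.+-monoʳ-≤ (a * a) (cross (r ∘ suc))) (cauchySchwarz (r ∘ suc)) ⟩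
    a * a + (k * (a * a) + S) + k * S   ≡⟨ collect (a * a) k S ⟩
    suc k * (a * a + S)                 ∎
    where
    a R S : ℕ
    a = r zero
    R = sum (r ∘ suc)
    S = sum (λ x → r (suc x) * r (suc x))
    expand : ∀ a R → (a + R) * (a + R) ≡ a * a + 2 * (a * R) + R * R
    expand = solve-∀
    collect : ∀ b k S → b + (k * b + S) + k * S ≡ suc k * (b + S)
    collect = solve-∀
    cross : ∀ {k} (r : Vector ℕ k) → 2 * (a * sum r) ≤ k * (a * a) + sum (λ x → r x * r x)
    cross {zero}  r = ℕ.≤-reflexive (cong (2 *_) (ℕ.*-zeroʳ a))
    cross {suc k} r = begin
      2 * (a * (r zero + sum (r ∘ suc)))                ≡⟨ split a (r zero) _ ⟩
      2 * (a * r zero) + 2 * (a * sum (r ∘ suc))        ≤⟨ ℕ.+-mono-≤ (2ab≤a²+b² a (r zero)) (cross (r ∘ suc)) ⟩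
      (a * a + r zero * r zero) + (k * (a * a) + T)     ≡⟨ regroup (a * a) (r zero * r zero) (k * (a * a)) T ⟩
      suc k * (a * a) + (r zero * r zero + T)           ∎
      where
      T : ℕ
      T = sum (λ x → r (suc x) * r (suc x))
      split : ∀ a x y → 2 * (a * (x + y)) ≡ 2 * (a * x) + 2 * (a * y)
      split = solve-∀
      regroup : ∀ p q s t → (p + q) + (s + t) ≡ (p + s) + (q + t)
      regroup = solve-∀

  product≢0 : ∀ x {y} → x * y ≢ 0 → x ≢ 0 × y ≢ 0
  product≢0 x {y} xy≢0 = (λ { ≡.refl → xy≢0 ≡.refl }) , (λ { ≡.refl → xy≢0 (ℕ.*-zeroʳ x) })

  -- Equally coloured pairs inject into Fin M, and by Cauchy-Schwarz there are
  -- at least N²/k of them.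
  N²≤k*M : ∀ {N k M} (colour : Fin N → Fin k) (code : Fin N → Fin N → Fin M) →
    (∀ {a b a′ b′} → colour a ≡ colour b → colour a′ ≡ colour b′ →
      code a b ≡ code a′ b′ → a ≡ a′ × b ≡ b′) →
    N * N ≤ k * M
  N²≤k*M {N} {k} {M} colour code code-injective = begin
    N * N                        ≡⟨ cong₂ _*_ Σr≡N Σr≡N ⟨
    sum r * sum r                ≤⟨ cauchySchwarz r ⟩
    k * sum (λ x → r x * r x)    ≤⟨ ℕ.*-monoʳ-≤ k Σr²≤M ⟩
    k * M                        ∎
    where
    c : Fin N → Fin k → ℕ
    c a x = indicator (colour a Fin.≟ x)

    r : Fin k → ℕ
    r x = sum (λ a → c a x)

    Σr≡N : sum r ≡ N
    Σr≡N = ≡.trans (∑-comm (λ x a → c a x))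
      (≡.trans (sum-cong-≗ (sum-indicator ∘ colour))
        (≡.trans (sum-const N 1) (ℕ.*-identityʳ N)))

    -- Indicates that `a` and `b` both have colour `x` and that their code is `y`. The total over
    -- all four indices counts the equally coloured pairs.
    w : Fin k → Fin N → Fin N → Fin M → ℕ
    w x a b y = c a x * (c b x * indicator (code a b Fin.≟ y))

    w≢0⇒ : ∀ x a b y → w x a b y ≢ 0 → colour a ≡ x × colour b ≡ x × code a b ≡ y
    w≢0⇒ x a b y ≢0
      with a≢0 , b,y≢0 ← product≢0 (c a x) ≢0
      with b≢0 , y≢0 ← product≢0 (c b x) b,y≢0
      = indicator≢0⇒ (colour a Fin.≟ x) a≢0 , indicator≢0⇒ (colour b Fin.≟ x) b≢0
      , indicator≢0⇒ (code a b Fin.≟ y) y≢0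

    -- Injectivity of the code leaves at most one triple `(x , a , b)` for each `y`, so each of the
    -- nested sums has at most one nonzero summand.
    fibre≤1 : ∀ y → sum (λ x → sum λ a → sum λ b → w x a b y) ≤ 1
    fibre≤1 y = sum≤1 (λ x → sum≤1 (λ a → sum≤1 (λ b → w≤1 x a b) (uniqᵇ x a)) (uniqᵃ x)) uniqˣ
      where
      w≤1 : ∀ x a b → w x a b y ≤ 1
      w≤1 x a b = ℕ.*-mono-≤ (indicator≤1 (colour a Fin.≟ x))
        (ℕ.*-mono-≤ (indicator≤1 (colour b Fin.≟ x)) (indicator≤1 (code a b Fin.≟ y)))

      uniq : ∀ {x a b x′ a′ b′} → w x a b y ≢ 0 → w x′ a′ b′ y ≢ 0 → x ≡ x′ × a ≡ a′ × b ≡ b′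
      uniq ≢0 ≢0′
        with ≡.refl , b~x , ≡.refl ← w≢0⇒ _ _ _ _ ≢0
        with ≡.refl , b~x′ , y≡ ← w≢0⇒ _ _ _ _ ≢0′
        with ≡.refl , ≡.refl ← code-injective (≡.sym b~x) (≡.sym b~x′) (≡.sym y≡)
        = ≡.refl , ≡.refl , ≡.refl

      uniqᵇ : ∀ x a b b′ → w x a b y ≢ 0 → w x a b′ y ≢ 0 → b ≡ b′
      uniqᵇ x a b b′ ≢0 ≢0′ = proj₂ (proj₂ (uniq ≢0 ≢0′))

      pickᵇ : ∀ x a → sum (λ b → w x a b y) ≢ 0 → ∃ λ b → w x a b y ≢ 0
      pickᵇ x a = sum≢0⇒∃ (λ b → w x a b y)

      pickᵃ : ∀ x → sum (λ a → sum λ b → w x a b y) ≢ 0 →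
        ∃ λ a → sum (λ b → w x a b y) ≢ 0
      pickᵃ x = sum≢0⇒∃ (λ a → sum λ b → w x a b y)

      uniqᵃ : ∀ x a a′ → sum (λ b → w x a b y) ≢ 0 → sum (λ b → w x a′ b y) ≢ 0 → a ≡ a′
      uniqᵃ x a a′ ≢0 ≢0′ =
        proj₁ (proj₂ (uniq (proj₂ (pickᵇ x a ≢0)) (proj₂ (pickᵇ x a′ ≢0′))))

      uniqˣ : ∀ x x′ → sum (λ a → sum λ b → w x a b y) ≢ 0 →
        sum (λ a → sum λ b → w x′ a b y) ≢ 0 → x ≡ x′
      uniqˣ x x′ ≢0 ≢0′
        with a , ≢0 ← pickᵃ x ≢0
        with a′ , ≢0′ ← pickᵃ x′ ≢0′ =
        proj₁ (uniq (proj₂ (pickᵇ x a ≢0)) (proj₂ (pickᵇ x′ a′ ≢0′)))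

    -- A factor `1` is expanded into the indicators of all codes, so that exchanging sums regroups
    -- the pairs by code.
    Σy : ∀ x a b → c a x * c b x ≡ sum (w x a b)
    Σy x a b = begin-equality
      c a x * c b x                   ≡⟨ cong (c a x *_) (ℕ.*-identityʳ _) ⟨
      c a x * (c b x * 1)             ≡⟨ cong (λ z → c a x * (c b x * z)) (sum-indicator (code a b)) ⟨
      c a x * (c b x * sum e)         ≡⟨ cong (c a x *_) (*-distribˡ-sum (c b x) e) ⟩
      c a x * sum (λ y → c b x * e y) ≡⟨ *-distribˡ-sum (c a x) (λ y → c b x * e y) ⟩
      sum (w x a b)                   ∎
      where
      e : Fin M → ℕ
      e y = indicator (code a b Fin.≟ y)

    r² : ∀ x → r x * r x ≡ sum (λ y → sum λ a → sum λ b → w x a b y)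
    r² x = begin-equality
      r x * r x                                ≡⟨ *-distribʳ-sum (r x) (λ a → c a x) ⟩
      sum (λ a → c a x * r x)                  ≡⟨ sum-cong-≗ (λ a → *-distribˡ-sum (c a x) (λ b → c b x)) ⟩
      sum (λ a → sum λ b → c a x * c b x)      ≡⟨ sum-cong-≗ (λ a → sum-cong-≗ λ b → Σy x a b) ⟩
      sum (λ a → sum λ b → sum λ y → w x a b y) ≡⟨ sum-cong-≗ (λ a → ∑-comm (w x a)) ⟩
      sum (λ a → sum λ y → sum λ b → w x a b y) ≡⟨ ∑-comm (λ a y → sum λ b → w x a b y) ⟩
      sum (λ y → sum λ a → sum λ b → w x a b y) ∎

    Σr²≤M : sum (λ x → r x * r x) ≤ M
    Σr²≤M = begin
      sum (λ x → r x * r x)                              ≡⟨ sum-cong-≗ r² ⟩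
      sum (λ x → sum λ y → sum λ a → sum λ b → w x a b y) ≡⟨ ∑-comm (λ x y → sum λ a → sum λ b → w x a b y) ⟩
      sum (λ y → sum λ x → sum λ a → sum λ b → w x a b y) ≤⟨ sum-mono-≤ fibre≤1 ⟩
      sum {M} (λ _ → 1)                                  ≡⟨ sum-const M 1 ⟩
      M * 1                                              ≡⟨ ℕ.*-identityʳ M ⟩
      M                                                  ∎

-- Coding equally coloured pairs by the cells of a grid

module Cells {n m k : ℕ} (L : ℕ) .{{_ : NonZero L}}
  (rank : Fin n → ℕ) (rank<n : ∀ i → rank i ℕ.< n)
  (rank-injective : ∀ {i j} → rank i ≡ rank j → i ≡ j)
  (colour : Fin n → Fin m → Fin k)
  -- The chain property: for fixed `t` and `t′` the matched pairs `(i , i′)` increase together.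
  (colour-mono : ∀ {i i′ j j′ t t′} → colour i t ≡ colour i′ t′ → colour j t ≡ colour j′ t′ →
    rank i ℕ.< rank j → rank i′ ℕ.< rank j′)
  (bit : Fin n → Fin n → Fin n → Fin n → Fin m → Fin m → Bool)
  -- With both points fixed, at most two off-diagonal pairs `(t , t′)` match them, and the bit tells
  -- these apart.
  (bit-determines : ∀ {i i′ j j′ t t′ u u′} → t ≢ t′ → u ≢ u′ → rank j ℕ.< rank i →
    colour i t ≡ colour i′ t′ → colour j t ≡ colour j′ t′ →
    colour i u ≡ colour i′ u′ → colour j u ≡ colour j′ u′ →
    bit i i′ j j′ t t′ ≡ bit i i′ j j′ u u′ → t ≡ u × t′ ≡ u′)
  where

  open import Data.Nat.Base using (_+_; _*_; _≤_; _<_)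

  -- Reading the matched pairs `(i , j)` and `(j , i)` through `colour-mono` would reverse a strict
  -- inequality between the ranks.
  colour-injective : ∀ {i j t} → colour i t ≡ colour j t → i ≡ j
  colour-injective {i} {j} eq with ℕ.<-cmp (rank i) (rank j)
  ... | tri< i<j _ _ = contradiction (colour-mono eq (≡.sym eq) i<j) (ℕ.<-asym i<j)
  ... | tri≈ _ i≡j _ = rank-injective i≡j
  ... | tri> _ _ j<i = contradiction (colour-mono (≡.sym eq) eq j<i) (ℕ.<-asym j<i)

  block residue : Fin n → ℕ
  block i = rank i / L
  residue i = rank i % L

  block-mono : ∀ {i j} → rank i < rank j → block i ≤ block j
  block-mono i<j = /-monoˡ-≤ L (ℕ.<⇒≤ i<j)

  block+residue-injective : ∀ {i j} → block i ≡ block j → residue i ≡ residue j → i ≡ j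
  block+residue-injective {i} {j} b≡ r≡ = rank-injective (≡.trans (m≡m%n+[m/n]*n (rank i) L)
    (≡.trans (cong₂ (λ r b → r + b * L) r≡ b≡) (≡.sym (m≡m%n+[m/n]*n (rank j) L))))

  residueFin : Fin n → Fin L
  residueFin i = fromℕ< (m%n<n (rank i) L)

  residueFin-injective : ∀ {i j} → residueFin i ≡ residueFin j → residue i ≡ residue j
  residueFin-injective = Fin.fromℕ<-injective _ _ _ _

  B : ℕ
  B = n / L

  block≤B : ∀ i → block i ≤ B
  block≤B i = /-monoˡ-≤ L (ℕ.<⇒≤ (rank<n i))

  -- Both block numbers are non-decreasing along a chain, so their sum alone distinguishes the cells
  -- it meets. The possible sums are `0` to `B + B`.
  blockSum : Fin n → Fin n → Fin (suc (B + B))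
  blockSum i i′ = fromℕ< (ℕ.s≤s (ℕ.+-mono-≤ (block≤B i) (block≤B i′)))

  blockSum-injective : ∀ {i i′ j j′} → blockSum i i′ ≡ blockSum j j′ →
    block i + block i′ ≡ block j + block j′
  blockSum-injective = Fin.fromℕ<-injective _ _ _ _

  -- Any earlier point of the chain in the same cell qualifies, not only the last one. When
  -- `(i , i′)` is on the chain too, `colour-mono` puts `j′` before `i′`.
  record Predecessor (i i′ : Fin n) (t t′ : Fin m) (j j′ : Fin n) : Set where
    constructor predecessor
    field
      j<i   : rank j < rank i
      j~i   : block j ≡ block i
      j′~i′ : block j′ ≡ block i′
      same  : colour j t ≡ colour j′ t′

  open Predecessor

  HasPredecessor : Fin n → Fin n → Fin m → Fin m → Set
  HasPredecessor i i′ t t′ = ∃₂ (Predecessor i i′ t t′)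

  hasPredecessor? : ∀ i i′ t t′ → Dec (HasPredecessor i i′ t t′)
  hasPredecessor? i i′ t t′ = Fin.any? λ j → Fin.any? λ j′ → predecessor? j j′
    where
    predecessor? : ∀ j j′ → Dec (Predecessor i i′ t t′ j j′)
    predecessor? j j′ with rank j ℕ.<? rank i ×-dec block j ℕ.≟ block i
                         ×-dec block j′ ℕ.≟ block i′ ×-dec colour j t Fin.≟ colour j′ t′
    ... | yes (p , q , r , s) = yes (predecessor p q r s)
    ... | no ¬p = no λ (predecessor p q r s) → ¬p (p , q , r , s)

  -- Codes of pairs with t = t′, of pairs without a predecessor, and of pairs with
  -- one; in the last case the cell of the predecessor is that of the pair itself.
  Code : Set
  Code = (Fin n × Fin m)
       ⊎ (Fin m × Fin m × Fin (suc (B + B)))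
       ⊎ (Fin n × Fin n × Fin L × Fin L × Bool)

  #codes : ℕ
  #codes = n * m + (m * (m * suc (B + B)) + n * (n * (L * (L * 2))))

  codes : Fin #codes ↔ Code
  codes = ↔-trans Fin.+↔⊎ (Fin.*↔× ⊎-↔ ↔-trans Fin.+↔⊎
    (↔-trans Fin.*↔× (↔-refl ×-↔ Fin.*↔×) ⊎-↔
     ↔-trans Fin.*↔× (↔-refl ×-↔ ↔-trans Fin.*↔× (↔-refl ×-↔
       ↔-trans Fin.*↔× (↔-refl ×-↔ ↔-trans Fin.*↔× (↔-refl ×-↔ Fin.2↔Bool))))))

  -- The decisions are explicit arguments so that the injectivity proof can split on them directly.
  codeBy : ∀ i i′ t t′ → Dec (t ≡ t′) → Dec (HasPredecessor i i′ t t′) → Code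
  codeBy i i′ t t′ (yes _) _                  = inj₁ (i , t)
  codeBy i i′ t t′ (no _)  (no _)             = inj₂ (inj₁ (t , t′ , blockSum i i′))
  codeBy i i′ t t′ (no _)  (yes (j , j′ , _)) =
    inj₂ (inj₂ (i , i′ , residueFin j , residueFin j′ , bit i i′ j j′ t t′))

  code : Fin n × Fin m → Fin n × Fin m → Code
  code (i , t) (i′ , t′) = codeBy i i′ t t′ (t Fin.≟ t′) (hasPredecessor? i i′ t t′)

  -- Two points without predecessors on one increasing curve lie in different
  -- cells, and along the curve the block sum then strictly increases.
  ¬predecessor-apart : ∀ {i i′ j j′ t t′} → colour i t ≡ colour i′ t′ →
    colour j t ≡ colour j′ t′ → ¬ HasPredecessor j j′ t t′ →
    block i + block i′ ≡ block j + block j′ → ¬ (rank i < rank j)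
  ¬predecessor-apart {i} {i′} {j} {j′} c≡ d≡ ¬pred sum≡ i<j = ¬pred
    (i , i′ , predecessor i<j
      (ℕ.≤-antisym i≤j (ℕ.+-cancelʳ-≤ (block j′) _ _
        (ℕ.≤-trans (ℕ.≤-reflexive (≡.sym sum≡)) (ℕ.+-monoʳ-≤ (block i) i′≤j′))))
      (ℕ.≤-antisym i′≤j′ (ℕ.+-cancelˡ-≤ (block j) _ _
        (ℕ.≤-trans (ℕ.≤-reflexive (≡.sym sum≡)) (ℕ.+-monoˡ-≤ (block i′) i≤j))))
      c≡)
    where
    i≤j : block i ≤ block j
    i≤j = block-mono i<j
    i′≤j′ : block i′ ≤ block j′
    i′≤j′ = block-mono (colour-mono c≡ d≡ i<j)

  codeBy-injective : ∀ {i i′ t t′ j j′ u u′} t≟ p? u≟ q? →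
    colour i t ≡ colour i′ t′ → colour j u ≡ colour j′ u′ →
    codeBy i i′ t t′ t≟ p? ≡ codeBy j j′ u u′ u≟ q? →
    (i , t) ≡ (j , u) × (i′ , t′) ≡ (j′ , u′)
  -- On the diagonal `t ≡ t′`, equal colours force `i ≡ i′`, so `(i , t)` already determines the
  -- pair.
  codeBy-injective (yes ≡.refl) _ (yes ≡.refl) _ c≡ d≡ ≡.refl
    with ≡.refl ← colour-injective c≡ | ≡.refl ← colour-injective d≡ = ≡.refl , ≡.refl
  codeBy-injective (yes _) _ (no _) (no _)  _ _ ()
  codeBy-injective (yes _) _ (no _) (yes _) _ _ ()
  codeBy-injective (no _) (no _)  (yes _) _ _ _ ()
  codeBy-injective (no _) (yes _) (yes _) _ _ _ ()
  codeBy-injective (no _) (no _)  (no _) (yes _) _ _ ()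
  codeBy-injective (no _) (yes _) (no _) (no _)  _ _ ()
  codeBy-injective {i} {i′} {t} {t′} {j} {j′} (no _) (no ¬p) (no _) (no ¬q) c≡ d≡ eq
    -- The functions under `cong` project components out of the code; their default clauses are
    -- arbitrary values for codes of another shape.
    with ≡.refl ← cong (λ { (inj₂ (inj₁ (t , _))) → t ; _ → t }) eq
       | ≡.refl ← cong (λ { (inj₂ (inj₁ (_ , t′ , _))) → t′ ; _ → t }) eq
       | sum≡ ← blockSum-injective {i} {i′} {j} {j′}
                  (cong (λ { (inj₂ (inj₁ (_ , _ , s))) → s ; _ → zero }) eq)
    -- Neither point can precede the other on the common chain, because `¬predecessor-apart` applies
    -- in both directions.
    with ≡.refl ← rank-injective {i} {j} (ℕ.≤-antisym
           (ℕ.≮⇒≥ (¬predecessor-apart d≡ c≡ ¬p (≡.sym sum≡)))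
           (ℕ.≮⇒≥ (¬predecessor-apart c≡ d≡ ¬q sum≡)))
    with ≡.refl ← colour-injective (≡.trans (≡.sym c≡) d≡)
    = ≡.refl , ≡.refl
  codeBy-injective {i} {i′} {t} {t′} (no t≢) (yes (j , j′ , p)) (no u≢) (yes (l , l′ , q)) c≡ d≡ eq
    with ≡.refl ← cong (λ { (inj₂ (inj₂ (i , _))) → i ; _ → i }) eq
       | ≡.refl ← cong (λ { (inj₂ (inj₂ (_ , i′ , _))) → i′ ; _ → i }) eq
       | r≡ ← residueFin-injective {j} {l}
                (cong (λ { (inj₂ (inj₂ (_ , _ , r , _))) → r ; _ → residueFin j }) eq)
       | r′≡ ← residueFin-injective {j′} {l′}
                (cong (λ { (inj₂ (inj₂ (_ , _ , _ , r , _))) → r ; _ → residueFin j }) eq)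
    -- The blocks of a predecessor are those of the pair itself, so together with the stored
    -- residues they recover it.
    with ≡.refl ← block+residue-injective {j} {l} (≡.trans (j~i p) (≡.sym (j~i q))) r≡
       | ≡.refl ← block+residue-injective {j′} {l′} (≡.trans (j′~i′ p) (≡.sym (j′~i′ q))) r′≡
    -- Both curves now pass through the same two points, and the stored bit decides between the two
    -- possible curves.
    with ≡.refl , ≡.refl ← bit-determines t≢ u≢ (j<i p) c≡ (same p) d≡ (same q)
           (cong (λ { (inj₂ (inj₂ (_ , _ , _ , _ , b))) → b ; _ → bit i i′ j j′ t t′ }) eq)
    = ≡.refl , ≡.refl

  [nm]²≤k*#codes : (n * m) * (n * m) ≤ k * #codes
  [nm]²≤k*#codes = N²≤k*M colourᴺ codeᴺ inj
    where
    pair : Fin (n * m) → Fin n × Fin m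
    pair = Inverse.to Fin.*↔×
    colourᴺ : Fin (n * m) → Fin k
    colourᴺ a = colour (proj₁ (pair a)) (proj₂ (pair a))
    codeᴺ : Fin (n * m) → Fin (n * m) → Fin #codes
    codeᴺ a b = Inverse.from codes (code (pair a) (pair b))
    pair-injective : ∀ {a b} → pair a ≡ pair b → a ≡ b
    pair-injective = Injection.injective (↔⇒↣ Fin.*↔×)
    from-injective : ∀ {x y} → Inverse.from codes x ≡ Inverse.from codes y → x ≡ y
    from-injective {x} {y} eq = ≡.trans (≡.sym (Inverse.strictlyInverseˡ codes x))
      (≡.trans (cong (Inverse.to codes) eq) (Inverse.strictlyInverseˡ codes y))
    inj : ∀ {a b a′ b′} → colourᴺ a ≡ colourᴺ b → colourᴺ a′ ≡ colourᴺ b′ →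
      codeᴺ a b ≡ codeᴺ a′ b′ → a ≡ a′ × b ≡ b′
    inj {a} {b} {a′} {b′} c≡ c′≡ eq
      with p , q ← codeBy-injective (proj₂ (pair a) Fin.≟ proj₂ (pair b)) (hasPredecessor? _ _ _ _)
             (proj₂ (pair a′) Fin.≟ proj₂ (pair b′)) (hasPredecessor? _ _ _ _) c≡ c′≡ (from-injective eq)
      = pair-injective p , pair-injective q

-- The numerical contradiction

module _ where
  open import Data.Nat.Base using (_+_; _*_; _^_; _≤_; _<_)
  open ℕ.≤-Reasoning

  -- After multiplication by `8`, the right-hand side splits into four terms, each at most `X`: so
  -- `8 * X ≤ 4 * X`, although `X` is positive. The choice of `L` bounds the term containing
  -- `n / L`.
  too-few-codes : ∀ {C L n m k} .{{_ : NonZero L}} → L ≡ 16 * C → k ≤ C * n →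
    8 * C ≤ n → 8 * C ≤ m → 16 * C * (L * L) * n ≤ m * m → 0 < n → 0 < m →
    ¬ ((n * m) * (n * m) ≤ k * (n * m + (m * (m * suc (n / L + n / L)) + n * (n * (L * (L * 2))))))
  too-few-codes {C} {L} {n} {m} {k} L≡16C k≤Cn 8C≤n 8C≤m Kn≤m² 0<n 0<m X≤ =
    ℕ.<⇒≱ (ℕ.*-mono-< (ℕ.*-mono-< 0<n 0<m) (ℕ.*-mono-< 0<n 0<m))
      -- The summand `4 * 0` on the right makes cancellation of `4 * X` and of the factor `4` end in
      -- `X ≤ 0`.
      (ℕ.*-cancelˡ-≤ 4 (ℕ.+-cancelˡ-≤ (4 * X) _ _ (begin
        4 * X + 4 * X ≡⟨ double X ⟩
        8 * X         ≤⟨ ℕ.*-monoʳ-≤ 8 X≤ ⟩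
        8 * (k * codes) ≤⟨ ℕ.*-monoʳ-≤ 8 (ℕ.*-monoˡ-≤ codes k≤Cn) ⟩
        8 * (C * n * codes) ≡⟨ expand C n m B L ⟩
        8 * C * (n * n * m) + (8 * C * (n * m * m) + 16 * C * B * (n * m * m)) + 16 * C * (L * L) * n * (n * n)
          ≤⟨ ℕ.+-mono-≤ (ℕ.+-mono-≤ (ℕ.*-monoˡ-≤ (n * n * m) 8C≤m)
               (ℕ.+-mono-≤ (ℕ.*-monoˡ-≤ (n * m * m) 8C≤n) (ℕ.*-monoˡ-≤ (n * m * m) 16CB≤n)))
               (ℕ.*-monoˡ-≤ (n * n) Kn≤m²) ⟩
        m * (n * n * m) + (n * (n * m * m) + n * (n * m * m)) + m * m * (n * n) ≡⟨ collect n m ⟩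
        4 * X + 4 * 0 ∎)))
    where
    B X codes : ℕ
    B = n / L
    X = (n * m) * (n * m)
    codes = n * m + (m * (m * suc (B + B)) + n * (n * (L * (L * 2))))
    16CB≤n : 16 * C * B ≤ n
    16CB≤n = begin
      16 * C * B ≡⟨ cong (_* B) L≡16C ⟨
      L * B      ≡⟨ ℕ.*-comm L B ⟩
      B * L      ≤⟨ m/n*n≤m n L ⟩
      n          ∎
    double : ∀ X → 4 * X + 4 * X ≡ 8 * X
    double = solve-∀
    expand : ∀ C n m B L → 8 * (C * n * (n * m + (m * (m * suc (B + B)) + n * (n * (L * (L * 2))))))
      ≡ 8 * C * (n * n * m) + (8 * C * (n * m * m) + 16 * C * B * (n * m * m)) + 16 * C * (L * L) * n * (n * n)
    expand = solve-∀
    collect : ∀ n m → m * (n * n * m) + (n * (n * m * m) + n * (n * m * m)) + m * m * (n * n)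
      ≡ 4 * ((n * m) * (n * m)) + 4 * 0
    collect = solve-∀

  ^-distribʳ-* : ∀ h a b → (a * b) ^ h ≡ a ^ h * b ^ h
  ^-distribʳ-* zero    a b = ≡.refl
  ^-distribʳ-* (suc h) a b = ≡.trans
    (cong (a * b *_) (^-distribʳ-* h a b)) (ℕ.[m*n]*[o*p]≡[m*o]*[n*p] a b (a ^ h) (b ^ h))

  -- The second hypothesis says that `m + 1` exceeds `n` to the power `1/2 + 1/(2h)`; the surplus
  -- absorbs constants. If `m² < K n`, then `(m + 1)² ≤ 2 (m² + 1) ≤ 2 K n`, whose `h`-th power is
  -- at most `n ^ suc h`.
  square-large : ∀ {K h n m} → (2 * K) ^ h ≤ n → n ^ suc h < suc m ^ (2 * h) → K * n ≤ m * m
  square-large {K} {h} {n} {m} n-large n^<m^ = ℕ.≮⇒≥ λ m²<Kn → ℕ.<⇒≱ n^<m^ (begin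
    suc m ^ (2 * h)         ≡⟨ ℕ.^-*-assoc (suc m) 2 h ⟨
    (suc m ^ 2) ^ h         ≤⟨ ℕ.^-monoˡ-≤ h (begin
      suc m ^ 2                     ≡⟨ square m ⟩
      suc (m * m) + 2 * (m * 1)     ≤⟨ ℕ.+-monoʳ-≤ (suc (m * m)) (2ab≤a²+b² m 1) ⟩
      suc (m * m) + (m * m + 1)     ≡⟨ double (m * m) ⟩
      2 * suc (m * m)               ≤⟨ ℕ.*-monoʳ-≤ 2 m²<Kn ⟩
      2 * (K * n)                   ≡⟨ ℕ.*-assoc 2 K n ⟨
      2 * K * n                     ∎) ⟩
    (2 * K * n) ^ h         ≡⟨ ^-distribʳ-* h (2 * K) n ⟩
    (2 * K) ^ h * n ^ h     ≤⟨ ℕ.*-monoˡ-≤ (n ^ h) n-large ⟩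
    n * n ^ h               ∎)
    where
    square : ∀ m → suc m ^ 2 ≡ suc (m * m) + 2 * (m * 1)
    square m = ≡.trans (cong (λ x → suc m * x) (ℕ.*-identityʳ (suc m))) (identity m)
      where
      identity : ∀ m → suc m * suc m ≡ suc (m * m) + 2 * (m * 1)
      identity = solve-∀
    double : ∀ x → suc x + (x + 1) ≡ 2 * suc x
    double = solve-∀

n<2^n : ∀ n → n ℕ.< 2 ℕ.^ n
n<2^n zero    = ℕ.≤-refl
n<2^n (suc n) = ℕ.≤-trans (ℕ.+-mono-≤ (ℕ.m^n>0 2 n) (n<2^n n))
  (ℕ.≤-reflexive (cong (2 ℕ.^ n ℕ.+_) (≡.sym (ℕ.+-identityʳ _))))

-- Polynomial identities with integer coefficients

module IntegerSolver {a ℓ} (R : CommutativeRing a ℓ) where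
  open import Data.Integer.Base using (+_; -[1+_])
  open CommutativeRing R
  open Algebra.Properties.Ring ring
  open Algebra.Properties.Semiring.Mult semiring renaming (_×_ to _·_)
  open Algebra.Properties.AbelianGroup +-abelianGroup using (⁻¹-∙-comm)
  open Relation.Binary.Reasoning.Setoid setoid

  ⟦_⟧ᶻ : ℤ → Carrier
  ⟦ + n ⟧ᶻ      = n · 1#
  ⟦ -[1+ n ] ⟧ᶻ = - (suc n · 1#)

  -‿homo : ∀ i → ⟦ ℤ.- i ⟧ᶻ ≈ - ⟦ i ⟧ᶻ
  -‿homo (+ zero)   = sym -0#≈0#
  -‿homo (+ suc n)  = refl
  -‿homo -[1+ n ]   = sym (-‿involutive _)

  -- Induction on both numbers: removing a `suc` from each amounts to inserting `1# - 1#`.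
  ⊖-homo : ∀ m n → ⟦ m ℤ.⊖ n ⟧ᶻ ≈ m · 1# - n · 1#
  ⊖-homo m       zero    = sym (trans (+-congˡ -0#≈0#) (+-identityʳ _))
  ⊖-homo zero    (suc n) = sym (+-identityˡ _)
  ⊖-homo (suc m) (suc n) = begin
    ⟦ suc m ℤ.⊖ suc n ⟧ᶻ               ≡⟨ cong ⟦_⟧ᶻ (ℤ.[1+m]⊖[1+n]≡m⊖n m n) ⟩
    ⟦ m ℤ.⊖ n ⟧ᶻ                       ≈⟨ ⊖-homo m n ⟩
    m · 1# - n · 1#                    ≈⟨ +-congʳ (+-identityˡ _) ⟨
    0# + m · 1# - n · 1#               ≈⟨ +-congʳ (+-congʳ (-‿inverseʳ 1#)) ⟨
    (1# - 1#) + m · 1# - n · 1#        ≈⟨ +-congʳ (+-assoc _ _ _) ⟩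
    (1# + (- 1# + m · 1#)) - n · 1#    ≈⟨ +-congʳ (+-congˡ (+-comm _ _)) ⟩
    (1# + (m · 1# - 1#)) - n · 1#      ≈⟨ +-congʳ (+-assoc _ _ _) ⟨
    (1# + m · 1# - 1#) - n · 1#        ≈⟨ +-assoc _ _ _ ⟩
    (1# + m · 1#) + (- 1# - n · 1#)    ≈⟨ +-congˡ (⁻¹-∙-comm _ _) ⟩
    (1# + m · 1#) - (1# + n · 1#)      ∎

  +-homo : ∀ i j → ⟦ i ℤ.+ j ⟧ᶻ ≈ ⟦ i ⟧ᶻ + ⟦ j ⟧ᶻ
  +-homo (+ m)      (+ n)      = ×-homo-+ 1# m n
  +-homo (+ m)      -[1+ n ]   = ⊖-homo m (suc n)
  +-homo -[1+ m ]   (+ n)      = trans (⊖-homo n (suc m)) (+-comm _ _)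
  +-homo -[1+ m ]   -[1+ n ]   = begin
    - (suc (suc (m ℕ.+ n)) · 1#)        ≡⟨ cong (λ k → - (suc k · 1#)) (ℕ.+-suc m n) ⟨
    - ((suc m ℕ.+ suc n) · 1#)          ≈⟨ -‿cong (×-homo-+ 1# (suc m) (suc n)) ⟩
    - (suc m · 1# + suc n · 1#)         ≈⟨ ⁻¹-∙-comm _ _ ⟨
    - (suc m · 1#) - (suc n · 1#)       ∎

  *-homo-pos : ∀ m j → ⟦ + m ℤ.* j ⟧ᶻ ≈ m · 1# * ⟦ j ⟧ᶻ
  *-homo-pos m (+ n)    = trans (reflexive (cong ⟦_⟧ᶻ (≡.sym (ℤ.pos-* m n)))) (×1-homo-* m n)
  *-homo-pos m -[1+ n ] = begin
    ⟦ + m ℤ.* -[1+ n ] ⟧ᶻ           ≡⟨ cong ⟦_⟧ᶻ (ℤ.neg-distribʳ-* (+ m) (+ suc n)) ⟨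
    ⟦ ℤ.- (+ m ℤ.* + suc n) ⟧ᶻ      ≈⟨ -‿homo (+ m ℤ.* + suc n) ⟩
    - ⟦ + m ℤ.* + suc n ⟧ᶻ          ≈⟨ -‿cong (*-homo-pos m (+ suc n)) ⟩
    - (m · 1# * (suc n · 1#))       ≈⟨ -‿distribʳ-* _ _ ⟩
    m · 1# * - (suc n · 1#)         ∎

  *-homo : ∀ i j → ⟦ i ℤ.* j ⟧ᶻ ≈ ⟦ i ⟧ᶻ * ⟦ j ⟧ᶻ
  *-homo (+ m)    j = *-homo-pos m j
  *-homo -[1+ m ] j = begin
    ⟦ -[1+ m ] ℤ.* j ⟧ᶻ             ≡⟨ cong ⟦_⟧ᶻ (ℤ.neg-distribˡ-* (+ suc m) j) ⟨
    ⟦ ℤ.- (+ suc m ℤ.* j) ⟧ᶻ        ≈⟨ -‿homo (+ suc m ℤ.* j) ⟩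
    - ⟦ + suc m ℤ.* j ⟧ᶻ            ≈⟨ -‿cong (*-homo-pos (suc m) j) ⟩
    - (suc m · 1# * ⟦ j ⟧ᶻ)         ≈⟨ -‿distribˡ-* _ _ ⟩
    - (suc m · 1#) * ⟦ j ⟧ᶻ         ∎

  morphism : ℤ.+-*-rawRing -Raw-AlmostCommutative⟶ fromCommutativeRing R
  morphism = record
    { ⟦_⟧    = ⟦_⟧ᶻ
    ; +-homo = +-homo
    ; *-homo = *-homo
    ; -‿homo = -‿homo
    ; 0-homo = refl
    ; 1-homo = +-identityʳ 1#
    }

  open Algebra.Solver.Ring ℤ.+-*-rawRing (fromCommutativeRing R) morphism
    (λ i j → Maybe.map (λ i≡j → reflexive (cong ⟦_⟧ᶻ i≡j)) (dec⇒maybe (i ℤ.≟ j))) public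
    using (solve; Polynomial; _:+_; _:*_; _:-_; :-_; _:=_)

-- Distances between two lines

module DistancesBetweenLines {ℓ} (R : CompleteOrderedField ℓ) where
  open RealPlane R
  open IntegerSolver commutativeRing using (solve; Polynomial; _:+_; _:*_; _:-_; :-_; _:=_)
  private
    module STO = IsStrictTotalOrder isStrictTotalOrder
    module MP = Algebra.Properties.Semiring.Mult semiring
    module RP = Algebra.Properties.Ring ring

  strictTotalOrder : StrictTotalOrder ℓ ℓ ℓ
  strictTotalOrder = record { isStrictTotalOrder = isStrictTotalOrder }

  open Relation.Binary.Reasoning.StrictPartialOrder
    (StrictTotalOrder.strictPartialOrder strictTotalOrder)

  -- Natural numbers and powers with real exponents

  fromℕ-mono-≤ : ∀ {m n} → m ℕ.≤ n → fromℕ m ≤ fromℕ n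
  fromℕ-mono-≤ m≤n with ℕ.m≤n⇒m<n∨m≡n m≤n
  ... | inj₁ m<n    = inj₁ (fromℕ-mono-< m<n)
  ... | inj₂ ≡.refl = inj₂ refl

  fromℕ-reflects-< : ∀ {m n} → fromℕ m < fromℕ n → m ℕ.< n
  fromℕ-reflects-< m<n = ℕ.≰⇒> λ n≤m → ≤⇒≯ (fromℕ-mono-≤ n≤m) m<n

  fromℕ-^ : ∀ a k → fromℕ (a ℕ.^ k) ≈ fromℕ a ^ k
  fromℕ-^ a zero    = +-identityʳ 1#
  fromℕ-^ a (suc k) = trans (MP.×1-homo-* a (a ℕ.^ k)) (*-congˡ (fromℕ-^ a k))

  2^root : ∀ p {x} → 0# ≤ x → ∃ λ z → 0# ≤ z × z ^ (2 ℕ.^ p) ≈ x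
  2^root zero    {x} 0≤x = x , 0≤x , *-identityʳ x
  2^root (suc p) {x} 0≤x with 2^root p 0≤x
  ... | y , 0≤y , y^≈x with squareRoot y 0≤y
  ... | z , 0≤z , zz≈y = z , 0≤z , (begin-equality
    z ^ (2 ℕ.* 2 ℕ.^ p)  ≈⟨ ^-assocʳ z 2 (2 ℕ.^ p) ⟨
    (z ^ 2) ^ (2 ℕ.^ p)  ≈⟨ ^-congˡ (2 ℕ.^ p) (trans (*-congˡ (*-identityʳ z)) zz≈y) ⟩
    y ^ (2 ℕ.^ p)        ≈⟨ y^≈x ⟩
    x                    ∎)

  -- ½ + 1/2ᵖ⁺¹ ≤ ½ + ε, and powers with dyadic exponents are available
  -- through iterated square roots.
  rounding-large : ∀ {ε} → 0# < ε → ∃ λ p → ∀ n .{{_ : NonZero n}} m →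
    m isRoundingOf (n ^ʳ (½ + ε)) → n ℕ.^ suc (2 ℕ.^ p) ℕ.< suc m ℕ.^ (2 ℕ.* 2 ℕ.^ p)
  rounding-large {ε} 0<ε with inverse ε (pos⇒≉0 0<ε)
  ... | ε⁻¹ , εε⁻¹≈1 with archimedean ε⁻¹
  ... | p , ε⁻¹<p = p , bound
    where
    h Q : ℕ
    h = 2 ℕ.^ p
    Q = 2 ℕ.* h

    -- `RationalPowers` takes its denominators in the form `suc q`.
    1+pred[Q]≡Q : suc (ℕ.pred Q) ≡ Q
    1+pred[Q]≡Q = ℕ.suc-pred Q {{ℕ.m^n≢0 2 (suc p)}}

    1≤hε : 1# ≤ fromℕ h * ε
    1≤hε = begin
      1#              ≈⟨ εε⁻¹≈1 ⟨
      ε * ε⁻¹         ≤⟨ *-monoˡ-≤ (inj₁ 0<ε) (inj₁ ε⁻¹<p) ⟩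
      ε * fromℕ p     ≤⟨ *-monoˡ-≤ (inj₁ 0<ε) (fromℕ-mono-≤ (ℕ.<⇒≤ (n<2^n p))) ⟩
      ε * fromℕ h     ≈⟨ *-comm ε _ ⟩
      fromℕ h * ε     ∎

    Q≈ : fromℕ Q ≈ fromℕ h * 2#
    Q≈ = begin-equality
      fromℕ Q              ≈⟨ MP.×1-homo-* 2 h ⟩
      fromℕ 2 * fromℕ h    ≈⟨ *-comm _ _ ⟩
      fromℕ h * fromℕ 2    ≈⟨ *-congˡ (+-congˡ (+-identityʳ 1#)) ⟩
      fromℕ h * 2#         ∎

    -- This is `(h + 1) / Q ≤ ½ + ε` with denominators cleared. Since `Q * (½ + ε)` is `h + 2hε`, it
    -- follows from `1≤hε`.
    exponent≤ : fromℕ (suc h) ≤ fromℕ (suc (ℕ.pred Q)) * (½ + ε) + fromℕ 0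
    exponent≤ = begin
      1# + fromℕ h                            ≤⟨ +-monoˡ-≤ _ (≤-trans 1≤hε (x≤x+y _ (≤-trans 0≤1 1≤hε))) ⟩
      (fromℕ h * ε + fromℕ h * ε) + fromℕ h   ≈⟨ +-comm _ _ ⟩
      fromℕ h + (fromℕ h * ε + fromℕ h * ε)   ≈⟨ +-cong
        (begin-equality
          fromℕ h                ≈⟨ *-identityʳ _ ⟨
          fromℕ h * 1#           ≈⟨ *-congˡ (proj₂ half) ⟨
          fromℕ h * (2# * ½)     ≈⟨ *-assoc _ _ _ ⟨
          fromℕ h * 2# * ½       ≈⟨ *-congʳ Q≈ ⟨
          fromℕ Q * ½            ∎)
        (begin-equality
          fromℕ h * ε + fromℕ h * ε   ≈⟨ distribʳ ε _ _ ⟨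
          (fromℕ h + fromℕ h) * ε     ≈⟨ *-congʳ (+-cong (*-identityʳ _) (*-identityʳ _)) ⟨
          (fromℕ h * 1# + fromℕ h * 1#) * ε     ≈⟨ *-congʳ (distribˡ _ 1# 1#) ⟨
          fromℕ h * 2# * ε            ≈⟨ *-congʳ Q≈ ⟨
          fromℕ Q * ε                 ∎) ⟩
      fromℕ Q * ½ + fromℕ Q * ε               ≈⟨ distribˡ _ ½ ε ⟨
      fromℕ Q * (½ + ε)                       ≈⟨ +-identityʳ _ ⟨
      fromℕ Q * (½ + ε) + fromℕ 0             ≡⟨ cong (λ q → fromℕ q * (½ + ε) + fromℕ 0) 1+pred[Q]≡Q ⟨
      fromℕ (suc (ℕ.pred Q)) * (½ + ε) + fromℕ 0 ∎

    bound : ∀ n .{{_ : NonZero n}} m → m isRoundingOf (n ^ʳ (½ + ε)) →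
      n ℕ.^ suc h ℕ.< suc m ℕ.^ Q
    -- The root `z` is `n` to the power `(h + 1) / Q`, one of the rational powers below the supremum
    -- `n ^ʳ (½ + ε)`, which is less than `m + 1`.
    bound n m (_ , n^<m+1) with 2^root (suc p) (pow-nonneg (suc h) (0≤fromℕ n))
    ... | z , 0≤z , z^Q≈ = fromℕ-reflects-< (begin-strict
      fromℕ (n ℕ.^ suc h)               ≈⟨ fromℕ-^ n (suc h) ⟩
      fromℕ n ^ suc h                   ≈⟨ z^Q≈ ⟨
      z ^ Q                             ≡⟨ cong (z ^_) (1+pred[Q]≡Q) ⟨
      z ^ suc (ℕ.pred Q)                <⟨ pow-mono-< (ℕ.pred Q) 0≤z z<m+1 ⟩
      fromℕ (suc m) ^ suc (ℕ.pred Q)    ≡⟨ cong (fromℕ (suc m) ^_) (1+pred[Q]≡Q) ⟩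
      fromℕ (suc m) ^ Q                 ≈⟨ fromℕ-^ (suc m) Q ⟨
      fromℕ (suc m ℕ.^ Q)               ∎)
      where
      z-power : RationalPowers (fromℕ n) (½ + ε) z
      z-power = 0≤z , suc h , 0 , ℕ.pred Q , exponent≤ , (begin-equality
        z ^ suc (ℕ.pred Q) * 1#  ≈⟨ *-identityʳ _ ⟩
        z ^ suc (ℕ.pred Q)       ≡⟨ cong (z ^_) (1+pred[Q]≡Q) ⟩
        z ^ Q                    ≈⟨ z^Q≈ ⟩
        fromℕ n ^ suc h          ∎)

      z<m+1 : z < fromℕ (suc m)
      z<m+1 = begin-strict
        z                ≤⟨ proj₁ (proj₂ (realPower (fromℕ n) (½ + ε) (1≤fromℕ n))) z-power ⟩
        n ^ʳ (½ + ε)     <⟨ n^<m+1 ⟩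
        fromℕ m + 1#     ≈⟨ +-comm _ _ ⟩
        1# + fromℕ m     ∎

  -- Zeros, signs and the two branches of a parabola

  x≈y⇒x-y≈0 : ∀ {x y} → x ≈ y → x - y ≈ 0#
  x≈y⇒x-y≈0 = RP.x≈y⇒x∙y⁻¹≈ε

  x-y≈0⇒x≈y : ∀ {x y} → x - y ≈ 0# → x ≈ y
  x-y≈0⇒x≈y = RP.x∙y⁻¹≈ε⇒x≈y _ _

  x<y⇒0<y-x : ∀ {x y} → x < y → 0# < y - x
  x<y⇒0<y-x {x} {y} x<y = begin-strict
    0#     ≈⟨ -‿inverseʳ x ⟨
    x - x  <⟨ +-monoˡ-< (- x) x<y ⟩
    y - x  ∎

  x<0⇒0<-x : ∀ {x} → x < 0# → 0# < - x
  x<0⇒0<-x {x} x<0 = begin-strict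
    0#       <⟨ x<y⇒0<y-x x<0 ⟩
    0# - x   ≈⟨ +-identityˡ _ ⟩
    - x      ∎

  x*y≈0⇒y≈0 : ∀ {x y} → ¬ (x ≈ 0#) → x * y ≈ 0# → y ≈ 0#
  x*y≈0⇒y≈0 {x} {y} x≉0 xy≈0 with inverse x x≉0
  ... | i , xi≈1 = begin-equality
    y            ≈⟨ *-identityˡ y ⟨
    1# * y       ≈⟨ *-congʳ xi≈1 ⟨
    x * i * y    ≈⟨ solve 3 (λ x i y → x :* i :* y := i :* (x :* y)) refl x i y ⟩
    i * (x * y)  ≈⟨ *-congˡ xy≈0 ⟩
    i * 0#       ≈⟨ zeroʳ i ⟩
    0#           ∎

  negative : ℝ → Bool
  negative x = does (x STO.<? 0#)

  -- Two negative numbers have a negative sum. Otherwise both are nonnegative, since `negative`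
  -- groups zero with the positive numbers, and neither can then be positive.
  same-sign-sum-zero : ∀ {x y} → negative x ≡ negative y → x + y ≈ 0# → x ≈ 0#
  same-sign-sum-zero {x} {y} eq x+y≈0 with x STO.<? 0# | y STO.<? 0#
  ... | yes x<0 | yes y<0 = contradiction (begin-strict
    0#      ≈⟨ x+y≈0 ⟨
    x + y   <⟨ +-monoˡ-< y x<0 ⟩
    0# + y  ≈⟨ +-identityˡ y ⟩
    y       <⟨ y<0 ⟩
    0#      ∎) (STO.irrefl refl)
  ... | no x≮0 | no y≮0 with ≮⇒≥ x≮0
  ...   | inj₂ 0≈x = sym 0≈x
  ...   | inj₁ 0<x = contradiction (begin-strict
    0#      <⟨ +-nonneg-pos (≮⇒≥ y≮0) 0<x ⟩
    y + x   ≈⟨ +-comm y x ⟩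
    x + y   ≈⟨ x+y≈0 ⟩
    0#      ∎) (STO.irrefl refl)

  -- The order in which a parabola takes its values: first the decreasing branch
  -- (true), then the increasing one (false).
  infix 4 _≺_
  _≺_ : Bool × ℝ → Bool × ℝ → Set ℓ
  (true  , x) ≺ (true  , y) = y < x
  (true  , x) ≺ (false , y) = Poly.⊤
  (false , x) ≺ (true  , y) = Poly.⊥
  (false , x) ≺ (false , y) = x < y

  ≺-irrefl : ∀ p → ¬ (p ≺ p)
  ≺-irrefl (true  , _) = STO.irrefl refl
  ≺-irrefl (false , _) = STO.irrefl refl

  ≺-asym : ∀ p q → p ≺ q → ¬ (q ≺ p)
  ≺-asym (true  , _) (true  , _) = STO.asym
  ≺-asym (false , _) (false , _) = STO.asym
  ≺-asym (true  , _) (false , _) _ ()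

  ≺-resp-≈ : ∀ b c {x y x′ y′} → x ≈ x′ → y ≈ y′ → (b , x) ≺ (c , y) → (b , x′) ≺ (c , y′)
  ≺-resp-≈ true  true  x≈ y≈ y<x = proj₁ STO.<-resp-≈ x≈ (proj₂ STO.<-resp-≈ y≈ y<x)
  ≺-resp-≈ false false x≈ y≈ x<y = proj₁ STO.<-resp-≈ y≈ (proj₂ STO.<-resp-≈ x≈ x<y)
  ≺-resp-≈ true  false _  _  _   = _

  -- Level curves of a quadratic polynomial

  module Quadratic (A B C D E F : ℝ) (0<A : 0# < A) (B≉0 : ¬ (B ≈ 0#)) (C≉0 : ¬ (C ≈ 0#))
    (Δ≉0 : ¬ (A * C - B * B ≈ 0#)) where

    -- `g` and `φ` are half the partial derivatives of `f` in `s` and in `t`. In particular `g s t`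
    -- vanishes at the vertex of the parabola `f` for fixed `t`.
    f g φ : ℝ → ℝ → ℝ
    f s t = A * (s * s) + (B + B) * (s * t) + C * (t * t) + (D + D) * s + (E + E) * t + F
    g s t = A * s + B * t + D
    φ s t = B * s + C * t + E

    private
      fᵖ : ∀ {n} (A B C D E F s t : Polynomial n) → Polynomial n
      fᵖ A B C D E F s t = A :* (s :* s) :+ (B :+ B) :* (s :* t) :+ C :* (t :* t)
        :+ (D :+ D) :* s :+ (E :+ E) :* t :+ F
      gᵖ : ∀ {n} (A B D s t : Polynomial n) → Polynomial n
      gᵖ A B D s t = A :* s :+ B :* t :+ D

    g-increasing : ∀ {s s′} t → s < s′ → g s t < g s′ t
    g-increasing {s} {s′} t s<s′ = begin-strict
      g s t                  <⟨ x<x+y _ (*-pos 0<A (x<y⇒0<y-x s<s′)) ⟩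
      g s t + A * (s′ - s)   ≈⟨ solve 6 (λ A B D s s′ t → gᵖ A B D s t :+ A :* (s′ :- s)
                                  := gᵖ A B D s′ t) refl A B D s s′ t ⟩
      g s′ t                 ∎

    -- The increment factors as `(s′ - s) * (g s t + g s′ t)`: the secant slope of a quadratic is
    -- the mean of its end derivatives.
    f-increasing : ∀ {s s′} t → s < s′ → 0# ≤ g s t → f s t < f s′ t
    f-increasing {s} {s′} t s<s′ 0≤g = begin-strict
      f s t
        <⟨ x<x+y _ (*-pos (x<y⇒0<y-x s<s′) (+-nonneg-pos 0≤g
             (begin-strict 0# ≤⟨ 0≤g ⟩ g s t <⟨ g-increasing t s<s′ ⟩ g s′ t ∎))) ⟩
      f s t + (s′ - s) * (g s t + g s′ t)
        ≈⟨ solve 9 (λ A B C D E F s s′ t → fᵖ A B C D E F s t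
             :+ (s′ :- s) :* (gᵖ A B D s t :+ gᵖ A B D s′ t) := fᵖ A B C D E F s′ t)
             refl A B C D E F s s′ t ⟩
      f s′ t ∎

    f-decreasing : ∀ {s s′} t → s < s′ → g s′ t < 0# → f s′ t < f s t
    f-decreasing {s} {s′} t s<s′ g<0 = begin-strict
      f s′ t
        <⟨ x<x+y _ (*-pos (x<y⇒0<y-x s<s′) (+-nonneg-pos
             (inj₁ (x<0⇒0<-x (begin-strict g s t <⟨ g-increasing t s<s′ ⟩ g s′ t <⟨ g<0 ⟩ 0# ∎)))
             (x<0⇒0<-x g<0))) ⟩
      f s′ t + (s′ - s) * (- g s t + - g s′ t)
        ≈⟨ solve 9 (λ A B C D E F s s′ t → fᵖ A B C D E F s′ t
             :+ (s′ :- s) :* (:- gᵖ A B D s t :+ :- gᵖ A B D s′ t) := fᵖ A B C D E F s t)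
             refl A B C D E F s s′ t ⟩
      f s t ∎

    branch : ℝ → ℝ → Bool
    branch s t = negative (g s t)

    -- As `g` increases in `s`, the branch can only switch from `true` to `false`; within one branch
    -- `f` is strictly monotone.
    f-≺ : ∀ {s s′} t → s < s′ → (branch s t , f s t) ≺ (branch s′ t , f s′ t)
    f-≺ {s} {s′} t s<s′ with g s t STO.<? 0# | g s′ t STO.<? 0#
    ... | yes _  | yes g′<0 = f-decreasing t s<s′ g′<0
    ... | yes _  | no  _    = _
    ... | no g≮0 | yes g′<0 = contradiction (STO.trans (g-increasing t s<s′) g′<0) g≮0
    ... | no g≮0 | no  _    = f-increasing t s<s′ (≮⇒≥ g≮0)

    -- If f s₁ t ≈ f s₁′ t′ and f s₂ t ≈ f s₂′ t′ have two solutions (t , t′), the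
    -- values of ψ at them are opposite, so that its sign tells them apart.
    ψ : (s₁ s₂ s₁′ s₂′ t t′ : ℝ) → ℝ
    ψ s₁ s₂ s₁′ s₂′ t t′ = (s₁′ - s₂′) * φ s₁ t - (s₁ - s₂) * φ s₁′ t′

    module TwoSolutions {s₁ s₂ s₁′ s₂′ t t′ u u′ : ℝ} (s₂<s₁ : s₂ < s₁) (s₂′<s₁′ : s₂′ < s₁′)
      (t₁ : f s₁ t ≈ f s₁′ t′) (t₂ : f s₂ t ≈ f s₂′ t′)
      (u₁ : f s₁ u ≈ f s₁′ u′) (u₂ : f s₂ u ≈ f s₂′ u′) where

      private
        a b : ℝ
        a = s₁ - s₂
        b = s₁′ - s₂′
        0<a : 0# < a
        0<a = x<y⇒0<y-x s₂<s₁
        0<b : 0# < b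
        0<b = x<y⇒0<y-x s₂′<s₁′

        minus-cong : ∀ {x x′ y y′} → x ≈ x′ → y ≈ y′ → x - y ≈ x′ - y′
        minus-cong x≈ y≈ = +-cong x≈ (-‿cong y≈)

        -- The mixed second difference of `f` retains only the `s * t` term.
        cross : ∀ s₁ s₂ t u → (B + B) * ((s₁ - s₂) * (t - u)) ≈ (f s₁ t - f s₂ t) - (f s₁ u - f s₂ u)
        cross = solve 10 (λ A B C D E F s₁ s₂ t u → (B :+ B) :* ((s₁ :- s₂) :* (t :- u))
          := (fᵖ A B C D E F s₁ t :- fᵖ A B C D E F s₂ t)
             :- (fᵖ A B C D E F s₁ u :- fᵖ A B C D E F s₂ u)) refl A B C D E F

        2x≈0⇒x≈0 : ∀ {x} → x + x ≈ 0# → x ≈ 0#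
        2x≈0⇒x≈0 x+x≈0 = same-sign-sum-zero ≡.refl x+x≈0

        2B≉0 : ¬ (B + B ≈ 0#)
        2B≉0 2B≈0 = B≉0 (2x≈0⇒x≈0 2B≈0)

        -- The four equations equate the mixed differences on both sides. Hence the two solutions
        -- lie on a line of slope `a / b` in the `(t , t′)` plane.
        aΔt≈bΔt′ : a * (t - u) ≈ b * (t′ - u′)
        aΔt≈bΔt′ = x-y≈0⇒x≈y (x*y≈0⇒y≈0 2B≉0 (begin-equality
          (B + B) * (a * (t - u) - b * (t′ - u′))                      ≈⟨ RP.x[y-z]≈xy-xz _ _ _ ⟩
          (B + B) * (a * (t - u)) - (B + B) * (b * (t′ - u′))          ≈⟨ x≈y⇒x-y≈0 (begin-equality
            (B + B) * (a * (t - u))                          ≈⟨ cross s₁ s₂ t u ⟩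
            (f s₁ t - f s₂ t) - (f s₁ u - f s₂ u)            ≈⟨ minus-cong (minus-cong t₁ t₂) (minus-cong u₁ u₂) ⟩
            (f s₁′ t′ - f s₂′ t′) - (f s₁′ u′ - f s₂′ u′)    ≈⟨ cross s₁′ s₂′ t′ u′ ⟨
            (B + B) * (b * (t′ - u′))                        ∎) ⟩
          0#                                                           ∎))

        x*0-x*0≈0 : ∀ {x y p q} → p ≈ 0# → q ≈ 0# → x * p - y * q ≈ 0#
        x*0-x*0≈0 {x} {y} p≈0 q≈0 = x≈y⇒x-y≈0
          (trans (*-congˡ p≈0) (trans (zeroʳ x) (sym (trans (*-congˡ q≈0) (zeroʳ y)))))

        Δf : ∀ s t u → f s t - f s u ≈ (t - u) * (φ s t + φ s u)
        Δf = solve 9 (λ A B C D E F s t u → fᵖ A B C D E F s t :- fᵖ A B C D E F s u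
          := (t :- u) :* ((B :* s :+ C :* t :+ E) :+ (B :* s :+ C :* u :+ E))) refl A B C D E F

        Δ′f : ∀ s₁ s₂ t → f s₁ t - f s₂ t ≈ (s₁ - s₂) * (g s₁ t + g s₂ t)
        Δ′f = solve 9 (λ A B C D E F s₁ s₂ t → fᵖ A B C D E F s₁ t :- fᵖ A B C D E F s₂ t
          := (s₁ :- s₂) :* (gᵖ A B D s₁ t :+ gᵖ A B D s₂ t)) refl A B C D E F

        ψₜ ψᵤ : ℝ
        ψₜ = ψ s₁ s₂ s₁′ s₂′ t t′
        ψᵤ = ψ s₁ s₂ s₁′ s₂′ u u′

      -- Along the line from `aΔt≈bΔt′`, the equation `f s₁ t ≈ f s₁′ t′` has degree at most two in
      -- one variable, and `ψ` is half its derivative. At two distinct roots the derivatives are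
      -- opposite.
      ψ-opposite : ¬ (t′ ≈ u′) → ψₜ + ψᵤ ≈ 0#
      ψ-opposite t′≉u′ = x*y≈0⇒y≈0 (λ eq → t′≉u′ (x-y≈0⇒x≈y eq)) (begin-equality
        (t′ - u′) * (ψₜ + ψᵤ)
          ≈⟨ solve 7 (λ x a b p p′ q q′ → x :* ((b :* p :- a :* p′) :+ (b :* q :- a :* q′))
               := (b :* x) :* (p :+ q) :- a :* (x :* (p′ :+ q′))) refl
               (t′ - u′) a b (φ s₁ t) (φ s₁′ t′) (φ s₁ u) (φ s₁′ u′) ⟩
        b * (t′ - u′) * (φ s₁ t + φ s₁ u) - a * ((t′ - u′) * (φ s₁′ t′ + φ s₁′ u′))
          ≈⟨ x≈y⇒x-y≈0 (begin-equality
               b * (t′ - u′) * (φ s₁ t + φ s₁ u)      ≈⟨ *-congʳ aΔt≈bΔt′ ⟨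
               a * (t - u) * (φ s₁ t + φ s₁ u)        ≈⟨ *-assoc _ _ _ ⟩
               a * ((t - u) * (φ s₁ t + φ s₁ u))      ≈⟨ *-congˡ (Δf s₁ t u) ⟨
               a * (f s₁ t - f s₁ u)                  ≈⟨ *-congˡ (minus-cong t₁ u₁) ⟩
               a * (f s₁′ t′ - f s₁′ u′)              ≈⟨ *-congˡ (Δf s₁′ t′ u′) ⟩
               a * ((t′ - u′) * (φ s₁′ t′ + φ s₁′ u′)) ∎) ⟩
        0# ∎)

      -- The difference of the two zero values of `ψ` is `C` times `b * (t - u) - a * (t′ - u′)`.
      -- Combined with `aΔt≈bΔt′` this gives `a² = b²`, and `a + b` is positive.
      a≈b : ¬ (t′ ≈ u′) → ψₜ ≈ 0# → ψᵤ ≈ 0# → a ≈ b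
      a≈b t′≉u′ ψₜ≈0 ψᵤ≈0 = x-y≈0⇒x≈y (x*y≈0⇒y≈0 (pos⇒≉0 (+-nonneg-pos (inj₁ 0<a) 0<b))
        (x*y≈0⇒y≈0 (λ eq → t′≉u′ (x-y≈0⇒x≈y eq)) (begin-equality
          x′ * ((a + b) * (a - b))          ≈⟨ solve 3 (λ x a b → x :* ((a :+ b) :* (a :- b))
                                                 := a :* (a :* x) :- b :* (b :* x)) refl x′ a b ⟩
          a * (a * x′) - b * (b * x′)       ≈⟨ minus-cong (*-congˡ (sym bΔt≈aΔt′)) (*-congˡ (sym aΔt≈bΔt′)) ⟩
          a * (b * (t - u)) - b * (a * (t - u)) ≈⟨ solve 3 (λ x a b → a :* (b :* x) :- b :* (a :* x)
                                                 := x :- x) refl (t - u) a b ⟩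
          (t - u) - (t - u)                 ≈⟨ -‿inverseʳ _ ⟩
          0#                                ∎)))
        where
        x′ : ℝ
        x′ = t′ - u′
        bΔt≈aΔt′ : b * (t - u) ≈ a * x′
        bΔt≈aΔt′ = x-y≈0⇒x≈y (x*y≈0⇒y≈0 C≉0 (begin-equality
          C * (b * (t - u) - a * (t′ - u′))
            ≈⟨ solve 11 (λ B C E s₁ s₁′ a b t t′ u u′ → C :* (b :* (t :- u) :- a :* (t′ :- u′))
                 := (b :* (B :* s₁ :+ C :* t :+ E) :- a :* (B :* s₁′ :+ C :* t′ :+ E))
                    :- (b :* (B :* s₁ :+ C :* u :+ E) :- a :* (B :* s₁′ :+ C :* u′ :+ E)))
                 refl B C E s₁ s₁′ a b t t′ u u′ ⟩
          ψₜ - ψᵤ     ≈⟨ minus-cong ψₜ≈0 ψᵤ≈0 ⟩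
          0# - 0#     ≈⟨ -‿inverseʳ 0# ⟩
          0#          ∎))

      -- Equal gaps make `φ` agree at `(s₁ , t)` and `(s₁′ , t′)`, and `g` likewise. So the matrix
      -- with rows `A , B` and `B , C` annihilates `(s₁ - s₁′ , t - t′)`, and its determinant is
      -- nonzero.
      degenerate : a ≈ b → ψₜ ≈ 0# → t ≈ t′
      degenerate a≈b ψₜ≈0 = x-y≈0⇒x≈y (x*y≈0⇒y≈0 Δ≉0 (begin-equality
        (A * C - B * B) * (t - t′)
          ≈⟨ solve 5 (λ A B C x y → (A :* C :- B :* B) :* y
               := A :* (B :* x :+ C :* y) :- B :* (A :* x :+ B :* y)) refl A B C (s₁ - s₁′) (t - t′) ⟩
        A * (B * (s₁ - s₁′) + C * (t - t′)) - B * (A * (s₁ - s₁′) + B * (t - t′))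
          ≈⟨ x*0-x*0≈0 φ-eq g-eq ⟩
        0# ∎))
        where
        φ-eq : B * (s₁ - s₁′) + C * (t - t′) ≈ 0#
        φ-eq = x*y≈0⇒y≈0 (pos⇒≉0 0<b) (begin-equality
          b * (B * (s₁ - s₁′) + C * (t - t′))
            ≈⟨ solve 8 (λ B C E s₁ s₁′ b t t′ → b :* (B :* (s₁ :- s₁′) :+ C :* (t :- t′))
                 := b :* (B :* s₁ :+ C :* t :+ E) :- b :* (B :* s₁′ :+ C :* t′ :+ E))
                 refl B C E s₁ s₁′ b t t′ ⟩
          b * φ s₁ t - b * φ s₁′ t′  ≈⟨ +-congˡ (-‿cong (*-congʳ a≈b)) ⟨
          b * φ s₁ t - a * φ s₁′ t′  ≈⟨ ψₜ≈0 ⟩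
          0#                         ∎)

        G G′ : ℝ
        G = g s₁ t + g s₂ t
        G′ = g s₁′ t′ + g s₂′ t′

        G-eq : G ≈ G′
        G-eq = x-y≈0⇒x≈y (x*y≈0⇒y≈0 (pos⇒≉0 0<b) (trans (RP.x[y-z]≈xy-xz _ _ _)
          (x≈y⇒x-y≈0 (begin-equality
            b * G                  ≈⟨ *-congʳ a≈b ⟨
            a * G                  ≈⟨ Δ′f s₁ s₂ t ⟨
            f s₁ t - f s₂ t        ≈⟨ minus-cong t₁ t₂ ⟩
            f s₁′ t′ - f s₂′ t′    ≈⟨ Δ′f s₁′ s₂′ t′ ⟩
            b * G′                 ∎))))

        g-eq : A * (s₁ - s₁′) + B * (t - t′) ≈ 0#
        g-eq = 2x≈0⇒x≈0 (begin-equality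
          (A * (s₁ - s₁′) + B * (t - t′)) + (A * (s₁ - s₁′) + B * (t - t′))
            ≈⟨ solve 9 (λ A B D s₁ s₂ s₁′ s₂′ t t′ →
                 (A :* (s₁ :- s₁′) :+ B :* (t :- t′)) :+ (A :* (s₁ :- s₁′) :+ B :* (t :- t′))
                 := ((gᵖ A B D s₁ t :+ gᵖ A B D s₂ t) :- (gᵖ A B D s₁′ t′ :+ gᵖ A B D s₂′ t′))
                    :+ A :* ((s₁ :- s₂) :- (s₁′ :- s₂′))) refl A B D s₁ s₂ s₁′ s₂′ t t′ ⟩
          (G - G′) + A * (a - b)   ≈⟨ +-cong (x≈y⇒x-y≈0 G-eq) (*-congˡ (x≈y⇒x-y≈0 a≈b)) ⟩
          0# + A * 0#              ≈⟨ +-identityˡ _ ⟩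
          A * 0#                   ≈⟨ zeroʳ A ⟩
          0#                       ∎)

      -- If `t′ ≈ u′`, the linear relation `aΔt≈bΔt′` gives the rest. Otherwise both values of `ψ`
      -- are opposite with equal sign, hence zero, and the degenerate case contradicts `t ≉ t′`.
      unique : ¬ (t ≈ t′) → negative ψₜ ≡ negative ψᵤ → t ≈ u × t′ ≈ u′
      unique t≉t′ sign≡ with t′ STO.≟ u′
      ... | yes t′≈u′ = x-y≈0⇒x≈y (x*y≈0⇒y≈0 (pos⇒≉0 0<a) (begin-equality
        a * (t - u)      ≈⟨ aΔt≈bΔt′ ⟩
        b * (t′ - u′)    ≈⟨ *-congˡ (x≈y⇒x-y≈0 t′≈u′) ⟩
        b * 0#           ≈⟨ zeroʳ b ⟩
        0#               ∎)) , t′≈u′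
      ... | no t′≉u′ = contradiction (degenerate (a≈b t′≉u′ ψₜ≈0 ψᵤ≈0) ψₜ≈0) t≉t′
        where
        ψₜ≈0 : ψₜ ≈ 0#
        ψₜ≈0 = same-sign-sum-zero sign≡ (ψ-opposite t′≉u′)
        ψᵤ≈0 : ψᵤ ≈ 0#
        ψᵤ≈0 = same-sign-sum-zero (≡.sym sign≡) (trans (+-comm ψᵤ ψₜ) (ψ-opposite t′≉u′))

  -- Ranks of parameters and colours of grid points

  module Rank {n} (s : Fin n → ℝ) (s-injective : ∀ {i j} → s i ≈ s j → i ≡ j) where

    rank : Fin n → ℕ
    rank i = sum (λ j → indicator (s j STO.<? s i))

    -- The index `i` does not count itself, so one of the `n` indicators is `0`.
    rank<n : ∀ i → rank i ℕ.< n
    rank<n i = ≡.subst (rank i ℕ.<_) (≡.trans (sum-const n 1) (ℕ.*-identityʳ n))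
      (sum-mono-< (λ j → indicator≤1 (s j STO.<? s i)) i
        (ℕ.s≤s (ℕ.≤-reflexive (indicator-no (s i STO.<? s i) (STO.irrefl refl)))))

    rank-mono : ∀ {i j} → s i < s j → rank i ℕ.< rank j
    rank-mono {i} {j} i<j = sum-mono-<
      (λ l → indicator-mono (s l STO.<? s i) (s l STO.<? s j) λ l<i → STO.trans l<i i<j) i
      (≡.subst₂ ℕ._<_ (≡.sym (indicator-no (s i STO.<? s i) (STO.irrefl refl)))
        (≡.sym (indicator-yes (s i STO.<? s j) i<j)) (ℕ.s≤s ℕ.z≤n))

    rank-injective : ∀ {i j} → rank i ≡ rank j → i ≡ j
    rank-injective {i} {j} eq with STO.compare (s i) (s j)
    ... | tri< i<j _ _ = contradiction eq (ℕ.<⇒≢ (rank-mono i<j))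
    ... | tri≈ _ i≈j _ = s-injective i≈j
    ... | tri> _ _ j<i = contradiction (≡.sym eq) (ℕ.<⇒≢ (rank-mono j<i))

    rank-reflects : ∀ {i j} → rank i ℕ.< rank j → s i < s j
    rank-reflects {i} {j} i<j with STO.compare (s i) (s j)
    ... | tri< si<sj _ _ = si<sj
    ... | tri≈ _ i≈j _ with ≡.refl ← s-injective i≈j = contradiction i<j (ℕ.<-irrefl ≡.refl)
    ... | tri> _ _ j<i = contradiction (rank-mono j<i) (ℕ.<-asym i<j)

  module Values {A B C D E F : ℝ} (0<A : 0# < A) (B≉0 : ¬ (B ≈ 0#)) (C≉0 : ¬ (C ≈ 0#))
    (Δ≉0 : ¬ (A * C - B * B ≈ 0#)) where
    open Quadratic A B C D E F 0<A B≉0 C≉0 Δ≉0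

    few-values⇒many-codes : ∀ {n m k} L .{{_ : NonZero L}}
      (s : Fin n → ℝ) → (∀ {i j} → s i ≈ s j → i ≡ j) →
      (τ : Fin m → ℝ) → (∀ {t u} → τ t ≈ τ u → t ≡ u) →
      (value : Fin n → Fin m → Fin k) →
      (∀ {i t i′ t′} → value i t ≡ value i′ t′ → f (s i) (τ t) ≈ f (s i′) (τ t′)) →
      (n ℕ.* m) ℕ.* (n ℕ.* m) ℕ.≤ (k ℕ.* 2) ℕ.* (n ℕ.* m ℕ.+
        (m ℕ.* (m ℕ.* suc (n / L ℕ.+ n / L)) ℕ.+ n ℕ.* (n ℕ.* (L ℕ.* (L ℕ.* 2)))))
    few-values⇒many-codes {n} {m} {k} L s s-injective τ τ-injective value value≡⇒f≈ =
      Cells.[nm]²≤k*#codes L rank rank<n rank-injective colour colour-mono bit bit-determines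
      where
      open Rank s s-injective

      side : Fin n → Fin m → Bool
      side i t = branch (s i) (τ t)

      -- A colour is a value together with a branch, which is why `k` values yield `k * 2` colours.
      colour : Fin n → Fin m → Fin (k ℕ.* 2)
      colour i t = combine (value i t) (Inverse.from Fin.2↔Bool (side i t))

      colour≡⇒f≈ : ∀ {i t i′ t′} → colour i t ≡ colour i′ t′ → f (s i) (τ t) ≈ f (s i′) (τ t′)
      colour≡⇒f≈ eq = value≡⇒f≈ (proj₁ (Fin.combine-injective _ _ _ _ eq))

      colour≡⇒side≡ : ∀ {i t i′ t′} → colour i t ≡ colour i′ t′ → side i t ≡ side i′ t′
      colour≡⇒side≡ {i} {t} {i′} {t′} eq = Injection.injective (↔⇒↣ (↔-sym Fin.2↔Bool))
        (proj₂ (Fin.combine-injective (value i t) _ (value i′ t′) _ eq))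

      key : Fin n → Fin m → Bool × ℝ
      key i t = side i t , f (s i) (τ t)

      colour-≺ : ∀ {i j i′ j′ t t′} → colour i t ≡ colour i′ t′ → colour j t ≡ colour j′ t′ →
        rank i ℕ.< rank j → key i′ t′ ≺ key j′ t′
      colour-≺ {i} {j} {i′} {j′} {t} {t′} c≡ d≡ i<j =
        ≺-resp-≈ (side i′ t′) (side j′ t′) (colour≡⇒f≈ c≡) (colour≡⇒f≈ d≡)
          (≡.subst₂ (λ b c → (b , f (s i) (τ t)) ≺ (c , f (s j) (τ t)))
            (colour≡⇒side≡ c≡) (colour≡⇒side≡ d≡) (f-≺ (τ t) (rank-reflects i<j)))

      -- The key strictly increases in `s` for fixed `t`, and matched points have equal keys. Thus
      -- the order of `i` and `j` passes through the keys to `i′` and `j′`.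
      colour-mono : ∀ {i i′ j j′ t t′} → colour i t ≡ colour i′ t′ →
        colour j t ≡ colour j′ t′ → rank i ℕ.< rank j → rank i′ ℕ.< rank j′
      colour-mono {i} {i′} {j} {j′} {t} {t′} c≡ d≡ i<j with STO.compare (s i′) (s j′)
      ... | tri< i′<j′ _ _ = rank-mono i′<j′
      ... | tri≈ _ i′≈j′ _ with ≡.refl ← s-injective i′≈j′ =
        contradiction (colour-≺ c≡ d≡ i<j) (≺-irrefl (key i′ t′))
      ... | tri> _ _ j′<i′ = contradiction (f-≺ (τ t′) j′<i′)
        (≺-asym (key i′ t′) (key j′ t′) (colour-≺ c≡ d≡ i<j))

      bit : Fin n → Fin n → Fin n → Fin n → Fin m → Fin m → Bool
      bit i i′ j j′ t t′ = negative (ψ (s i) (s j) (s i′) (s j′) (τ t) (τ t′))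

      bit-determines : ∀ {i i′ j j′ t t′ u u′} → t ≢ t′ → u ≢ u′ → rank j ℕ.< rank i →
        colour i t ≡ colour i′ t′ → colour j t ≡ colour j′ t′ →
        colour i u ≡ colour i′ u′ → colour j u ≡ colour j′ u′ →
        bit i i′ j j′ t t′ ≡ bit i i′ j j′ u u′ → t ≡ u × t′ ≡ u′
      bit-determines t≢t′ _ j<i c₁ c₂ d₁ d₂ bit≡ =
        let t≈u , t′≈u′ = TwoSolutions.unique (rank-reflects j<i)
              (rank-reflects (colour-mono c₂ c₁ j<i))
              (colour≡⇒f≈ c₁) (colour≡⇒f≈ c₂) (colour≡⇒f≈ d₁) (colour≡⇒f≈ d₂)
              (t≢t′ ∘ τ-injective) bit≡
        in τ-injective t≈u , τ-injective t′≈u′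

  -- The squared distance between points of two lines

  det : ℝ² → ℝ² → ℝ
  det (u₁ , u₂) (v₁ , v₂) = u₁ * v₂ - u₂ * v₁

  -- The factor is the quotient of the coordinates of the two directions at a place where
  -- `direction l` is nonzero.
  det≈0⇒Parallel : ∀ (l m : Line) → det (direction l) (direction m) ≈ 0# → Parallel l m
  det≈0⇒Parallel l m det≈0 with direction l | direction m | direction≉0 l
  ... | u₁ , u₂ | v₁ , v₂ | u≉0 with u₁ STO.≟ 0# | u₂ STO.≟ 0#
  ... | yes u₁≈0 | yes u₂≈0 = contradiction (u₁≈0 , u₂≈0) u≉0
  ... | no u₁≉0  | _ with i , u₁i≈1 ← inverse u₁ u₁≉0 = i * v₁
    , (begin-equality
        v₁              ≈⟨ *-identityˡ v₁ ⟨
        1# * v₁         ≈⟨ *-congʳ u₁i≈1 ⟨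
        u₁ * i * v₁     ≈⟨ solve 3 (λ u i v → u :* i :* v := i :* v :* u) refl u₁ i v₁ ⟩
        i * v₁ * u₁     ∎)
    , (begin-equality
        v₂              ≈⟨ *-identityˡ v₂ ⟨
        1# * v₂         ≈⟨ *-congʳ u₁i≈1 ⟨
        u₁ * i * v₂     ≈⟨ solve 3 (λ u i v → u :* i :* v := i :* (u :* v)) refl u₁ i v₂ ⟩
        i * (u₁ * v₂)   ≈⟨ *-congˡ (x-y≈0⇒x≈y det≈0) ⟩
        i * (u₂ * v₁)   ≈⟨ solve 3 (λ u i v → i :* (u :* v) := i :* v :* u) refl u₂ i v₁ ⟩
        i * v₁ * u₂     ∎)
  ... | yes _ | no u₂≉0 with i , u₂i≈1 ← inverse u₂ u₂≉0 = i * v₂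
    , (begin-equality
        v₁              ≈⟨ *-identityˡ v₁ ⟨
        1# * v₁         ≈⟨ *-congʳ u₂i≈1 ⟨
        u₂ * i * v₁     ≈⟨ solve 3 (λ u i v → u :* i :* v := i :* (u :* v)) refl u₂ i v₁ ⟩
        i * (u₂ * v₁)   ≈⟨ *-congˡ (x-y≈0⇒x≈y det≈0) ⟨
        i * (u₁ * v₂)   ≈⟨ solve 3 (λ u i v → i :* (u :* v) := i :* v :* u) refl u₁ i v₂ ⟩
        i * v₂ * u₁     ∎)
    , (begin-equality
        v₂              ≈⟨ *-identityˡ v₂ ⟨
        1# * v₂         ≈⟨ *-congʳ u₂i≈1 ⟨
        u₂ * i * v₂     ≈⟨ solve 3 (λ u i v → u :* i :* v := i :* v :* u) refl u₂ i v₂ ⟩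
        i * v₂ * u₂     ∎)

  square-pos : ∀ {x} → ¬ (x ≈ 0#) → 0# < x * x
  square-pos {x} x≉0 with square-nonneg x
  ... | inj₁ 0<xx = 0<xx
  ... | inj₂ 0≈xx = contradiction (x*y≈0⇒y≈0 x≉0 (sym 0≈xx)) x≉0

  d² : ∀ p q → d p q * d p q ≈
    (proj₁ p - proj₁ q) * (proj₁ p - proj₁ q) + (proj₂ p - proj₂ q) * (proj₂ p - proj₂ q)
  d² (x₁ , y₁) (x₂ , y₂) = proj₂ (proj₂ (squareRoot _
    (+-nonneg (square-nonneg (x₁ - x₂)) (square-nonneg (y₁ - y₂)))))

  module TwoLines (ℓ₁ ℓ₂ : Line) (det≉0 : ¬ (det (direction ℓ₁) (direction ℓ₂) ≈ 0#))
    (¬orthogonal : ¬ Orthogonal ℓ₁ ℓ₂) where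

    private
      u v w : ℝ²
      u = direction ℓ₁
      v = direction ℓ₂
      w = proj₁ (base ℓ₁) - proj₁ (base ℓ₂) , proj₂ (base ℓ₁) - proj₂ (base ℓ₂)

    -- The coefficients of `|w + s u - t v|²`, whence the minus signs in `B` and `E`. The prime
    -- avoids a clash with the distance set `D`.
    A B C D′ E F : ℝ
    A = u ∙ u
    B = - (u ∙ v)
    C = v ∙ v
    D′ = w ∙ u
    E = - (w ∙ v)
    F = w ∙ w

    B≉0 : ¬ (B ≈ 0#)
    B≉0 B≈0 = ¬orthogonal (trans (sym (RP.-‿involutive _)) (trans (-‿cong B≈0) RP.-0#≈0#))

    lagrange : det u v * det u v ≈ A * C - B * B
    lagrange = solve 4 (λ u₁ u₂ v₁ v₂ → (u₁ :* v₂ :- u₂ :* v₁) :* (u₁ :* v₂ :- u₂ :* v₁)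
      := (u₁ :* u₁ :+ u₂ :* u₂) :* (v₁ :* v₁ :+ v₂ :* v₂)
         :- (:- (u₁ :* v₁ :+ u₂ :* v₂)) :* (:- (u₁ :* v₁ :+ u₂ :* v₂))) refl
      (proj₁ u) (proj₂ u) (proj₁ v) (proj₂ v)

    Δ≉0 : ¬ (A * C - B * B ≈ 0#)
    Δ≉0 Δ≈0 = pos⇒≉0 (square-pos det≉0) (trans lagrange Δ≈0)

    -- By `lagrange`, `A * C` is `det u v * det u v + B * B`, a sum of two positive squares.
    AC≉0 : ¬ (A * C ≈ 0#)
    AC≉0 = pos⇒≉0 (begin-strict
      0#                               <⟨ +-nonneg-pos (inj₁ (square-pos det≉0)) (square-pos B≉0) ⟩
      det u v * det u v + B * B        ≈⟨ +-congʳ lagrange ⟩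
      A * C - B * B + B * B            ≈⟨ solve 2 (λ x y → x :- y :+ y := x) refl (A * C) (B * B) ⟩
      A * C                            ∎)

    0<A : 0# < A
    0<A with +-nonneg (square-nonneg (proj₁ u)) (square-nonneg (proj₂ u))
    ... | inj₁ 0<A = 0<A
    ... | inj₂ 0≈A = contradiction (trans (*-congʳ (sym 0≈A)) (zeroˡ C)) AC≉0

    C≉0 : ¬ (C ≈ 0#)
    C≉0 C≈0 = AC≉0 (trans (*-congˡ C≈0) (zeroʳ A))

    open Quadratic A B C D′ E F 0<A B≉0 C≉0 Δ≉0 using (f)

    d²≈f : ∀ {p q s t} → p ≈² base ℓ₁ +² s *² u → q ≈² base ℓ₂ +² t *² v →
      d p q * d p q ≈ f s t
    d²≈f {p} {q} {s} {t} (p₁≈ , p₂≈) (q₁≈ , q₂≈) = trans (d² p q)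
      (trans (+-cong (*-cong δ₁ δ₁) (*-cong δ₂ δ₂)) expand)
      where
      δ₁ = +-cong p₁≈ (-‿cong q₁≈)
      δ₂ = +-cong p₂≈ (-‿cong q₂≈)
      x₁ = proj₁ (base ℓ₁)
      x₂ = proj₂ (base ℓ₁)
      y₁ = proj₁ (base ℓ₂)
      y₂ = proj₂ (base ℓ₂)
      expand : ((x₁ + s * proj₁ u) - (y₁ + t * proj₁ v)) * ((x₁ + s * proj₁ u) - (y₁ + t * proj₁ v))
        + ((x₂ + s * proj₂ u) - (y₂ + t * proj₂ v)) * ((x₂ + s * proj₂ u) - (y₂ + t * proj₂ v)) ≈ f s t
      expand = solve 10 (λ x₁ x₂ y₁ y₂ u₁ u₂ v₁ v₂ s t →
        let B = :- (u₁ :* v₁ :+ u₂ :* v₂)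
            w₁ = x₁ :- y₁
            w₂ = x₂ :- y₂
            D = w₁ :* u₁ :+ w₂ :* u₂
            E = :- (w₁ :* v₁ :+ w₂ :* v₂) in
        ((x₁ :+ s :* u₁) :- (y₁ :+ t :* v₁)) :* ((x₁ :+ s :* u₁) :- (y₁ :+ t :* v₁))
          :+ ((x₂ :+ s :* u₂) :- (y₂ :+ t :* v₂)) :* ((x₂ :+ s :* u₂) :- (y₂ :+ t :* v₂))
        := (u₁ :* u₁ :+ u₂ :* u₂) :* (s :* s) :+ (B :+ B) :* (s :* t)
           :+ (v₁ :* v₁ :+ v₂ :* v₂) :* (t :* t) :+ (D :+ D) :* s :+ (E :+ E) :* t
           :+ (w₁ :* w₁ :+ w₂ :* w₂)) refl x₁ x₂ y₁ y₂ (proj₁ u) (proj₂ u) (proj₁ v) (proj₂ v) s t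

    few-distances⇒many-codes : ∀ {n m k} (P₁ P₂ : Pred ℝ² ℓ) L .{{_ : NonZero L}} →
      P₁ ⊆ ⟦ ℓ₁ ⟧ → HasSize ℝ²-setoid P₁ n → P₂ ⊆ ⟦ ℓ₂ ⟧ → HasSize ℝ²-setoid P₂ m →
      HasSize ℝ-setoid (D P₁ P₂) k →
      (n ℕ.* m) ℕ.* (n ℕ.* m) ℕ.≤ (k ℕ.* 2) ℕ.* (n ℕ.* m ℕ.+
        (m ℕ.* (m ℕ.* suc (n / L ℕ.+ n / L)) ℕ.+ n ℕ.* (n ℕ.* (L ℕ.* (L ℕ.* 2)))))
    few-distances⇒many-codes {n} {m} {k} P₁ P₂ L P₁⊆ size₁ P₂⊆ size₂ sizeᴰ =
      Values.few-values⇒many-codes 0<A B≉0 C≉0 Δ≉0 L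
        s (on-line-injective size₁ ℓ₁ P₁⊆) τ (on-line-injective size₂ ℓ₂ P₂⊆) value value≡⇒f≈
      where
      parameter : ∀ {n P} → HasSize ℝ²-setoid P n → ∀ l → P ⊆ ⟦ l ⟧ → Fin n → ℝ
      parameter size l P⊆ i = proj₁ (P⊆ (proj₂ (Bijection.to size i)))

      on-line-injective : ∀ {n P} (size : HasSize ℝ²-setoid P n) l (P⊆ : P ⊆ ⟦ l ⟧) → ∀ {i j} →
        parameter size l P⊆ i ≈ parameter size l P⊆ j → i ≡ j
      on-line-injective size l P⊆ {i} {j} s≈ =
        let p₁≈ , p₂≈ = proj₂ (P⊆ (proj₂ (Bijection.to size i)))
            q₁≈ , q₂≈ = proj₂ (P⊆ (proj₂ (Bijection.to size j)))
        in Bijection.injective size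
             ( trans p₁≈ (trans (+-congˡ (*-congʳ s≈)) (sym q₁≈))
             , trans p₂≈ (trans (+-congˡ (*-congʳ s≈)) (sym q₂≈)))

      s : Fin n → ℝ
      s = parameter size₁ ℓ₁ P₁⊆
      τ : Fin m → ℝ
      τ = parameter size₂ ℓ₂ P₂⊆

      p : Fin n → ℝ²
      p i = proj₁ (Bijection.to size₁ i)
      q : Fin m → ℝ²
      q t = proj₁ (Bijection.to size₂ t)

      distance : Fin n → Fin m → ∃ (D P₁ P₂)
      distance i t = d (p i) (q t) , p i , q t , proj₂ (Bijection.to size₁ i)
        , proj₂ (Bijection.to size₂ t) , refl

      -- An index of the distance in the enumeration of `D P₁ P₂`. Equal indices give equal
      -- distances, hence equal squared distances.
      value : Fin n → Fin m → Fin k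
      value i t = proj₁ (Bijection.strictlySurjective sizeᴰ (distance i t))

      value-correct : ∀ i t → proj₁ (Bijection.to sizeᴰ (value i t)) ≈ d (p i) (q t)
      value-correct i t = proj₂ (Bijection.strictlySurjective sizeᴰ (distance i t))

      value≡⇒f≈ : ∀ {i t i′ t′} → value i t ≡ value i′ t′ → f (s i) (τ t) ≈ f (s i′) (τ t′)
      value≡⇒f≈ {i} {t} {i′} {t′} eq = trans (sym (f≈ i t)) (trans (*-cong d≈ d≈) (f≈ i′ t′))
        where
        f≈ : ∀ i t → d (p i) (q t) * d (p i) (q t) ≈ f (s i) (τ t)
        f≈ i t = d²≈f (proj₂ (P₁⊆ (proj₂ (Bijection.to size₁ i))))
          (proj₂ (P₂⊆ (proj₂ (Bijection.to size₂ t))))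
        d≈ : d (p i) (q t) ≈ d (p i′) (q t′)
        d≈ = trans (sym (value-correct i t)) (trans
          (reflexive (cong (proj₁ ∘ Bijection.to sizeᴰ) eq)) (value-correct i′ t′))

  few-distances⇒parallel-or-orthogonal : ∀ (ℓ₁ ℓ₂ : Line) (P₁ P₂ : Pred ℝ² ℓ) {n m k} C .{{_ : NonZero C}} →
    k ℕ.* 2 ℕ.≤ C ℕ.* n → 8 ℕ.* C ℕ.≤ n →
    16 ℕ.* C ℕ.* ((16 ℕ.* C) ℕ.* (16 ℕ.* C)) ℕ.* n ℕ.≤ m ℕ.* m →
    P₁ ⊆ ⟦ ℓ₁ ⟧ → HasSize ℝ²-setoid P₁ n → P₂ ⊆ ⟦ ℓ₂ ⟧ → HasSize ℝ²-setoid P₂ m →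
    HasSize ℝ-setoid (D P₁ P₂) k → Parallel ℓ₁ ℓ₂ ⊎ Orthogonal ℓ₁ ℓ₂
  few-distances⇒parallel-or-orthogonal ℓ₁ ℓ₂ P₁ P₂ {n} {m} {k} C@(suc _) 2k≤Cn 8C≤n Kn≤m² P₁⊆ size₁ P₂⊆ size₂ sizeᴰ
    with det (direction ℓ₁) (direction ℓ₂) STO.≟ 0# | (direction ℓ₁ ∙ direction ℓ₂) STO.≟ 0#
  ... | yes det≈0 | _             = inj₁ (det≈0⇒Parallel ℓ₁ ℓ₂ det≈0)
  ... | no _      | yes orthogonal = inj₂ orthogonal
  ... | no det≉0  | no ¬orthogonal = contradiction
    (TwoLines.few-distances⇒many-codes ℓ₁ ℓ₂ det≉0 ¬orthogonal P₁ P₂ (16 ℕ.* C)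
      P₁⊆ size₁ P₂⊆ size₂ sizeᴰ)
    (too-few-codes {C} ≡.refl 2k≤Cn 8C≤n 8C≤m Kn≤m² (ℕ.<-≤-trans 0<8C 8C≤n) (ℕ.<-≤-trans 0<8C 8C≤m))
    where
    0<8C : 0 ℕ.< 8 ℕ.* C
    0<8C = ℕ.s≤s ℕ.z≤n
    8C≤m : 8 ℕ.* C ℕ.≤ m
    -- If `m < 8C`, then `m² < (8C)² ≤ (8C)² * 64C = (16C)³ = K ≤ K * n`.
    8C≤m = ℕ.≮⇒≥ λ m<8C → ℕ.<⇒≱ (ℕ.*-mono-< m<8C m<8C) (ℕ.≤-trans [8C]²≤K*n Kn≤m²)
      where
      K : ℕ
      K = 16 ℕ.* C ℕ.* ((16 ℕ.* C) ℕ.* (16 ℕ.* C))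
      identity : ∀ C → 8 ℕ.* C ℕ.* (8 ℕ.* C) ℕ.* (64 ℕ.* C) ≡ 16 ℕ.* C ℕ.* ((16 ℕ.* C) ℕ.* (16 ℕ.* C))
      identity = solve-∀
      [8C]²≤K*n : 8 ℕ.* C ℕ.* (8 ℕ.* C) ℕ.≤ K ℕ.* n
      [8C]²≤K*n = ℕ.≤-trans (ℕ.m≤m*n _ (64 ℕ.* C)) (ℕ.≤-trans (ℕ.≤-reflexive (identity C))
        (ℕ.m≤m*n K n {{ℕ.>-nonZero (ℕ.<-≤-trans 0<8C 8C≤n)}}))

-- Choice of the constants

theorem5p2 : ∀ {ℓ} (R : CompleteOrderedField ℓ) → let open RealPlane R in
    ∀ (c ε : ℝ) → 0# < c → 0# < ε →
    ∃ λ (n₀ : ℕ) → ∀ (n : ℕ) .{{_ : NonZero n}} → n₀ ℕ.< n →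
    ∀ (ℓ₁ ℓ₂ : Line) (P₁ P₂ : Pred ℝ² ℓ) (m k : ℕ) →
    P₁ ⊆ ⟦ ℓ₁ ⟧ → HasSize ℝ²-setoid P₁ n →
    P₂ ⊆ ⟦ ℓ₂ ⟧ → HasSize ℝ²-setoid P₂ m → m isRoundingOf (n ^ʳ (½ + ε)) →
    HasSize ℝ-setoid (D P₁ P₂) k → fromℕ k < c * fromℕ n →
    Parallel ℓ₁ ℓ₂ ⊎ Orthogonal ℓ₁ ℓ₂
-- The threshold is the lower bound on `n` required by `square-large` with `h = 2 ^ p`.
theorem5p2 R c ε 0<c 0<ε = (2 ℕ.* K) ℕ.^ (2 ℕ.^ p) ,
  λ n n₀<n ℓ₁ ℓ₂ P₁ P₂ m k P₁⊆ size₁ P₂⊆ size₂ m≈ sizeᴰ k<cn →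
  few-distances⇒parallel-or-orthogonal ℓ₁ ℓ₂ P₁ P₂ C (2k≤Cn n k k<cn) (ℕ.≤-trans 8C≤n₀ (ℕ.<⇒≤ n₀<n))
    (square-large {K} {2 ℕ.^ p} (ℕ.<⇒≤ n₀<n) (proj₂ large n m m≈)) P₁⊆ size₁ P₂⊆ size₂ sizeᴰ
  where
  open RealPlane R
  open DistancesBetweenLines R
  open Relation.Binary.Reasoning.StrictPartialOrder
    (StrictTotalOrder.strictPartialOrder strictTotalOrder)
  module MP = Algebra.Properties.Semiring.Mult semiring

  -- The `suc` makes `C` visibly nonzero. The factor `2` in `C` accounts for the two branches, and
  -- `K` is `16 C L²` for the block length `L = 16 C`.
  c₀ C K p : ℕ
  c₀ = suc (proj₁ (archimedean c))
  C = c₀ ℕ.* 2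
  K = 16 ℕ.* C ℕ.* ((16 ℕ.* C) ℕ.* (16 ℕ.* C))

  large = rounding-large 0<ε
  p = proj₁ large

  c<c₀ : c < fromℕ c₀
  c<c₀ = begin-strict
    c                                 <⟨ proj₂ (archimedean c) ⟩
    fromℕ (proj₁ (archimedean c))     ≤⟨ fromℕ-mono-≤ (ℕ.n≤1+n (proj₁ (archimedean c))) ⟩
    fromℕ c₀                          ∎

  2k≤Cn : ∀ n k → fromℕ k < c * fromℕ n → k ℕ.* 2 ℕ.≤ C ℕ.* n
  2k≤Cn n k k<cn = ℕ.≤-trans (ℕ.*-monoˡ-≤ 2 (fromℕ-reflects-≤ {k} {c₀ ℕ.* n} (begin
    fromℕ k               ≤⟨ inj₁ k<cn ⟩
    c * fromℕ n           ≤⟨ *-monoʳ-≤ (0≤fromℕ n) (inj₁ c<c₀) ⟩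
    fromℕ c₀ * fromℕ n    ≈⟨ MP.×1-homo-* c₀ n ⟨
    fromℕ (c₀ ℕ.* n)      ∎))) (ℕ.≤-reflexive (swap c₀ n))
    where
    swap : ∀ x y → x ℕ.* y ℕ.* 2 ≡ x ℕ.* 2 ℕ.* y
    swap = solve-∀

  -- `8C` divides `2 * K`, which is at most each of its positive powers.
  8C≤n₀ : 8 ℕ.* C ℕ.≤ (2 ℕ.* K) ℕ.^ (2 ℕ.^ p)
  8C≤n₀ = ℕ.≤-trans (ℕ.m≤m*n _ (4 ℕ.* (16 ℕ.* C ℕ.* (16 ℕ.* C))))
    (ℕ.≤-trans (ℕ.≤-reflexive (≡.trans (identity C) (≡.sym (ℕ.^-identityʳ (2 ℕ.* K)))))
      (ℕ.^-monoʳ-≤ (2 ℕ.* K) (ℕ.m^n>0 2 p)))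
    where
    identity : ∀ C → 8 ℕ.* C ℕ.* (4 ℕ.* (16 ℕ.* C ℕ.* (16 ℕ.* C)))
      ≡ 2 ℕ.* (16 ℕ.* C ℕ.* ((16 ℕ.* C) ℕ.* (16 ℕ.* C)))
    identity = solve-∀
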